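{- Let $n\ge 2$ be an integer and let $S_n=K_{1,n-1}$ be the star graph on $n$ vertices. Then: (i) the Randić characteristic polynomial of $S_n$ is $RP(S_n,\lambda)=\lambda^{n-2}(\lambda^2-1)$; (ii) the Randić energy of $S_n$ is $RE(S_n)=2$.
   Context: All graphs are finite and simple. For a graph $G$ with vertices $v_1,\dots,v_n$ of degrees $d_1,\dots,d_n$, the Randić matrix $R(G)$ is the $n\times n$ real symmetric matrix with $(i,j)$-entry $\frac{1}{\sqrt{d_id_j}}$ if $v_i$ and $v_j$ are adjacent, and $0$ otherwise. The Randić characteristic polynomial of $G$ is $RP(G,\lambda)=\det(\lambda I-R(G))$. The Randić energy of $G$ is $RE(G)=\sum_{i=1}^n|\rho_i|$, where $\rho_1,\dots,\rho_n$ are the eigenvalues of $R(G)$ counted with multiplicity. -}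

module Defs where

open import Algebra.Bundles.Raw using (RawRing)
import Algebra.Definitions.RawSemiring as RawSemiringDefs
open import Data.Bool.Base using (if_then_else_)
open import Data.Fin.Base using (Fin; zero; suc; toℕ; punchIn)
import Data.Fin.Properties as Fin
open import Data.Integer.Base using (+_)
import Data.Integer.Base as ℤ
import Data.Integer.Properties as ℤ
open import Data.List.Base using (length; filter; allFin)
open import Data.List.Membership.Propositional using (lose)
open import Data.List.Membership.Propositional.Properties using (∈-allFin)
open import Data.List.Properties using (filter-some)
open import Data.Nat.Base as ℕ using (ℕ; zero; suc; NonZero)
import Data.Nat.Properties as ℕ
open import Data.Product.Base using (∃; ∃-syntax; _×_; _,_)
open import Data.Nat.Solver using () renaming (module +-*-Solver to ℕS)
open import Data.Rational.Base as ℚ using (ℚ; 0ℚ; 1ℚ; ½; positive; nonNegative)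
import Data.Rational.Properties as ℚ
open import Data.Rational.Solver using (module +-*-Solver)
import Data.Rational.Unnormalised.Base as ℚᵘ
import Data.Rational.Unnormalised.Properties as ℚᵘ
open import Data.Sum.Base using (_⊎_; inj₁; inj₂)
open import Data.Vec.Functional using (Vector)
open import Level using (0ℓ)
open import Relation.Binary.Core using (Rel)
open import Relation.Binary.Definitions using (Decidable; Symmetric)
open import Relation.Binary.PropositionalEquality using (_≡_; refl; sym; trans; cong; cong₂; subst; subst₂)
open import Relation.Nullary using (¬_; yes; no; does; contradiction; _×-dec_; _⊎-dec_)

module ℚ-Lemmas where

  0<½ : 0ℚ ℚ.< ½
  0<½ = ℚ.positive⁻¹ ½

  0<1 : 0ℚ ℚ.< 1ℚ
  0<1 = ℚ.positive⁻¹ 1ℚ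

  0<* : ∀ {p q} → 0ℚ ℚ.< p → 0ℚ ℚ.< q → 0ℚ ℚ.< p ℚ.* q
  0<* {p} {q} 0<p 0<q =
    ℚ.positive⁻¹ (p ℚ.* q) {{ℚ.pos*pos⇒pos p {{positive 0<p}} q {{positive 0<q}}}}

  ½ε+½ε≡ε : ∀ ε → ½ ℚ.* ε ℚ.+ ½ ℚ.* ε ≡ ε
  ½ε+½ε≡ε ε = trans (sym (ℚ.*-distribʳ-+ ε ½ ½)) (ℚ.*-identityˡ ε)

  [a+b]-[c+d] : ∀ a b c d → (a ℚ.+ b) ℚ.- (c ℚ.+ d) ≡ (a ℚ.- c) ℚ.+ (b ℚ.- d)
  [a+b]-[c+d] = solve 4 (λ a b c d → (a :+ b) :- (c :+ d) := (a :- c) :+ (b :- d)) refl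
    where open +-*-Solver

  ab-cd : ∀ a b c d → a ℚ.* b ℚ.- c ℚ.* d ≡ a ℚ.* (b ℚ.- d) ℚ.+ d ℚ.* (a ℚ.- c)
  ab-cd = solve 4 (λ a b c d → a :* b :- c :* d := a :* (b :- d) :+ d :* (a :- c)) refl
    where open +-*-Solver

  ab[c-d] : ∀ a b c d → (a ℚ.* b) ℚ.* (c ℚ.- d) ≡ b ℚ.* (a ℚ.* c) ℚ.- a ℚ.* (b ℚ.* d)
  ab[c-d] = solve 4 (λ a b c d → (a :* b) :* (c :- d) := b :* (a :* c) :- a :* (b :* d)) refl
    where open +-*-Solver

  b-a : ∀ a b → b ℚ.- a ≡ ℚ.- (a ℚ.- b)
  b-a = solve 2 (λ a b → b :- a := :- (a :- b)) refl
    where open +-*-Solver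

  -a--b : ∀ a b → b ℚ.- a ≡ (ℚ.- a) ℚ.- (ℚ.- b)
  -a--b = solve 2 (λ a b → b :- a := (:- a) :- (:- b)) refl
    where open +-*-Solver

  ∣p-q∣≡∣q-p∣ : ∀ p q → ℚ.∣ p ℚ.- q ∣ ≡ ℚ.∣ q ℚ.- p ∣
  ∣p-q∣≡∣q-p∣ p q =
    trans (cong ℚ.∣_∣ (b-a q p)) (ℚ.∣-p∣≡∣p∣ (q ℚ.- p))

  ∣p∣≤∣q∣+∣p-q∣ : ∀ p q → ℚ.∣ p ∣ ℚ.≤ ℚ.∣ q ∣ ℚ.+ ℚ.∣ p ℚ.- q ∣
  ∣p∣≤∣q∣+∣p-q∣ p q =
    subst (λ r → ℚ.∣ r ∣ ℚ.≤ ℚ.∣ q ∣ ℚ.+ ℚ.∣ p ℚ.- q ∣)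
      (solve 2 (λ a b → b :+ (a :- b) := a) refl p q)
      (ℚ.∣p+q∣≤∣p∣+∣q∣ q (p ℚ.- q))
    where open +-*-Solver

  p≤∣p∣ : ∀ p → p ℚ.≤ ℚ.∣ p ∣
  p≤∣p∣ p with ℚ.≤-total 0ℚ p
  ... | inj₁ 0≤p = ℚ.≤-reflexive (sym (ℚ.0≤p⇒∣p∣≡p 0≤p))
  ... | inj₂ p≤0 = ℚ.≤-trans p≤0 (ℚ.0≤∣p∣ p)

  ∣p∣< : ∀ {p q} → p ℚ.< q → ℚ.- p ℚ.< q → ℚ.∣ p ∣ ℚ.< q
  ∣p∣< {p} {q} p<q -p<q with ℚ.∣p∣≡p∨∣p∣≡-p p
  ... | inj₁ e = subst (ℚ._< q) (sym e) p<q
  ... | inj₂ e = subst (ℚ._< q) (sym e) -p<q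

  p-q<r : ∀ {p q r} → p ℚ.< q ℚ.+ r → p ℚ.- q ℚ.< r
  p-q<r {p} {q} {r} p<q+r =
    subst (p ℚ.- q ℚ.<_) (solve 2 (λ a b → (a :+ b) :- a := b) refl q r)
      (ℚ.+-monoˡ-< (ℚ.- q) p<q+r)
    where open +-*-Solver

  ∣∣p∣-∣q∣∣≤∣p-q∣ : ∀ p q {ε} → ℚ.∣ p ℚ.- q ∣ ℚ.< ε → ℚ.∣ ℚ.∣ p ∣ ℚ.- ℚ.∣ q ∣ ∣ ℚ.< ε
  ∣∣p∣-∣q∣∣≤∣p-q∣ p q {ε} h = ∣p∣<
    (p-q<r (ℚ.≤-<-trans (∣p∣≤∣q∣+∣p-q∣ p q) (ℚ.+-monoʳ-< ℚ.∣ q ∣ h)))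
    (subst (ℚ._< ε) (b-a ℚ.∣ p ∣ ℚ.∣ q ∣)
      (p-q<r (ℚ.≤-<-trans (∣p∣≤∣q∣+∣p-q∣ q p)
        (ℚ.+-monoʳ-< ℚ.∣ p ∣ (subst (ℚ._< ε) (∣p-q∣≡∣q-p∣ p q) h)))))

  *-mono-≤-< : ∀ {a b c d} → 0ℚ ℚ.< b → 0ℚ ℚ.≤ c → a ℚ.≤ b → c ℚ.< d → a ℚ.* c ℚ.< b ℚ.* d
  *-mono-≤-< {a} {b} {c} {d} 0<b 0≤c a≤b c<d = ℚ.≤-<-trans
    (ℚ.*-monoʳ-≤-nonNeg c {{nonNegative 0≤c}} a≤b)
    (ℚ.*-monoʳ-<-pos b {{positive 0<b}} c<d)

  ∣+∣< : ∀ a b c d {ε} → ℚ.∣ a ℚ.- c ∣ ℚ.< ½ ℚ.* ε → ℚ.∣ b ℚ.- d ∣ ℚ.< ½ ℚ.* ε →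
         ℚ.∣ (a ℚ.+ b) ℚ.- (c ℚ.+ d) ∣ ℚ.< ε
  ∣+∣< a b c d {ε} h₁ h₂ = subst₂ ℚ._<_ (cong ℚ.∣_∣ (sym ([a+b]-[c+d] a b c d))) (½ε+½ε≡ε ε)
    (ℚ.≤-<-trans (ℚ.∣p+q∣≤∣p∣+∣q∣ (a ℚ.- c) (b ℚ.- d)) (ℚ.+-mono-< h₁ h₂))

  ∣*∣< : ∀ a b c d {A B α β ε} → 0ℚ ℚ.< A → 0ℚ ℚ.< B →
         A ℚ.* α ≡ ½ ℚ.* ε → B ℚ.* β ≡ ½ ℚ.* ε →
         ℚ.∣ a ∣ ℚ.≤ A → ℚ.∣ d ∣ ℚ.≤ B →
         ℚ.∣ b ℚ.- d ∣ ℚ.< α → ℚ.∣ a ℚ.- c ∣ ℚ.< β →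
         ℚ.∣ a ℚ.* b ℚ.- c ℚ.* d ∣ ℚ.< ε
  ∣*∣< a b c d {A} {B} {α} {β} {ε} 0<A 0<B Aα≡ Bβ≡ a≤A d≤B b-d<α a-c<β = begin-strict
    ℚ.∣ a ℚ.* b ℚ.- c ℚ.* d ∣
      ≡⟨ cong ℚ.∣_∣ (ab-cd a b c d) ⟩
    ℚ.∣ a ℚ.* (b ℚ.- d) ℚ.+ d ℚ.* (a ℚ.- c) ∣
      ≤⟨ ℚ.∣p+q∣≤∣p∣+∣q∣ (a ℚ.* (b ℚ.- d)) (d ℚ.* (a ℚ.- c)) ⟩
    ℚ.∣ a ℚ.* (b ℚ.- d) ∣ ℚ.+ ℚ.∣ d ℚ.* (a ℚ.- c) ∣
      ≡⟨ cong₂ ℚ._+_ (ℚ.∣p*q∣≡∣p∣*∣q∣ a (b ℚ.- d)) (ℚ.∣p*q∣≡∣p∣*∣q∣ d (a ℚ.- c)) ⟩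
    ℚ.∣ a ∣ ℚ.* ℚ.∣ b ℚ.- d ∣ ℚ.+ ℚ.∣ d ∣ ℚ.* ℚ.∣ a ℚ.- c ∣
      <⟨ ℚ.+-mono-< (*-mono-≤-< 0<A (ℚ.0≤∣p∣ (b ℚ.- d)) a≤A b-d<α)
                    (*-mono-≤-< 0<B (ℚ.0≤∣p∣ (a ℚ.- c)) d≤B a-c<β) ⟩
    A ℚ.* α ℚ.+ B ℚ.* β
      ≡⟨ trans (cong₂ ℚ._+_ Aα≡ Bβ≡) (½ε+½ε≡ε ε) ⟩
    ε ∎
    where open ℚ.≤-Reasoning

  divide : ∀ {b ε} → 0ℚ ℚ.< b → 0ℚ ℚ.< ε → ∃[ δ ] (0ℚ ℚ.< δ × b ℚ.* δ ≡ ε)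
  divide {b} {ε} 0<b 0<ε =
      1/b ℚ.* ε
    , 0<* (ℚ.positive⁻¹ 1/b {{ℚ.1/pos⇒pos b {{positive 0<b}}}}) 0<ε
    , trans (sym (ℚ.*-assoc b 1/b ε))
        (trans (cong (ℚ._* ε) (ℚ.*-inverseʳ b {{b≢0}})) (ℚ.*-identityˡ ε))
    where
    b≢0 : ℚ.NonZero b
    b≢0 = ℚ.pos⇒nonZero b {{positive 0<b}}
    1/b : ℚ
    1/b = (ℚ.1/ b) {{b≢0}}

  /-mono-< : ∀ i j c d → i ℤ.* + suc d ℤ.< j ℤ.* + suc c → i ℚ./ suc c ℚ.< j ℚ./ suc d
  /-mono-< i j c d h = ℚ.toℚᵘ-cancel-<
    (ℚᵘ.<-respˡ-≃ (ℚᵘ.≃-sym (ℚ.toℚᵘ-fromℚᵘ (ℚᵘ.mkℚᵘ i c)))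
      (ℚᵘ.<-respʳ-≃ (ℚᵘ.≃-sym (ℚ.toℚᵘ-fromℚᵘ (ℚᵘ.mkℚᵘ j d))) (ℚᵘ.*<* h)))

  /-mono-≤ : ∀ i j c d → i ℤ.* + suc d ℤ.≤ j ℤ.* + suc c → i ℚ./ suc c ℚ.≤ j ℚ./ suc d
  /-mono-≤ i j c d h = ℚ.toℚᵘ-cancel-≤
    (ℚᵘ.≤-respˡ-≃ (ℚᵘ.≃-sym (ℚ.toℚᵘ-fromℚᵘ (ℚᵘ.mkℚᵘ i c)))
      (ℚᵘ.≤-respʳ-≃ (ℚᵘ.≃-sym (ℚ.toℚᵘ-fromℚᵘ (ℚᵘ.mkℚᵘ j d))) (ℚᵘ.*≤* h)))

  /-+ : ∀ i j d → (i ℤ.+ j) ℚ./ suc d ≡ i ℚ./ suc d ℚ.+ j ℚ./ suc d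
  /-+ i j d = ℚ.toℚᵘ-injective (ℚᵘ.≃-trans (ℚ.toℚᵘ-fromℚᵘ (ℚᵘ.mkℚᵘ (i ℤ.+ j) d))
    (ℚᵘ.≃-sym (ℚᵘ.≃-trans (ℚ.toℚᵘ-homo-+ (i ℚ./ suc d) (j ℚ./ suc d))
      (ℚᵘ.≃-trans
        (ℚᵘ.+-cong (ℚ.toℚᵘ-fromℚᵘ (ℚᵘ.mkℚᵘ i d)) (ℚ.toℚᵘ-fromℚᵘ (ℚᵘ.mkℚᵘ j d)))
        (ℚᵘ.*≡* eq)))))
    where
    D = + suc d
    eq : (i ℤ.* D ℤ.+ j ℤ.* D) ℤ.* D ≡ (i ℤ.+ j) ℤ.* (D ℤ.* D)
    eq = trans (cong (ℤ._* D) (sym (ℤ.*-distribʳ-+ D i j))) (ℤ.*-assoc (i ℤ.+ j) D D)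

  archimedean : ∀ ε → 0ℚ ℚ.< ε → ∃[ N ] (∀ n → N ℕ.≤ n → + 1 ℚ./ suc n ℚ.< ε)
  archimedean ε@(ℚ.mkℚ ℤ.+[1+ p ] d-1 _) _ = suc d-1 , λ n N≤n →
    subst (+ 1 ℚ./ suc n ℚ.<_) (ℚ.↥p/↧p≡p ε) (/-mono-< (+ 1) ℤ.+[1+ p ] n d-1 (ℤ.+<+ (begin-strict
      1 ℕ.* suc d-1      ≡⟨ ℕ.*-identityˡ (suc d-1) ⟩
      suc d-1            <⟨ ℕ.s≤s N≤n ⟩
      suc n              ≤⟨ ℕ.m≤m+n (suc n) (p ℕ.* suc n) ⟩
      suc p ℕ.* suc n    ∎)))
    where open ℕ.≤-Reasoning
  archimedean (ℚ.mkℚ (+ 0) _ _) (ℚ.*<* (ℤ.+<+ ()))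
  archimedean (ℚ.mkℚ ℤ.-[1+ _ ] _ _) (ℚ.*<* ())

open ℚ-Lemmas

-- ℝ is the setoid of Cauchy sequences of rationals under _≈_.
IsCauchy : (ℕ → ℚ) → Set
IsCauchy s = ∀ ε → 0ℚ ℚ.< ε →
  ∃[ N ] (∀ m n → N ℕ.≤ m → N ℕ.≤ n → ℚ.∣ s m ℚ.- s n ∣ ℚ.< ε)

record ℝ : Set where
  constructor mkℝ
  field
    seq    : ℕ → ℚ
    cauchy : IsCauchy seq

open ℝ public

infix  4 _≈_
infix  8 -_
infixl 7 _*_
infixl 6 _+_ _-_

_≈_ : Rel ℝ 0ℓ
x ≈ y = ∀ ε → 0ℚ ℚ.< ε → ∃[ N ] (∀ n → N ℕ.≤ n → ℚ.∣ seq x n ℚ.- seq y n ∣ ℚ.< ε)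

fromℚ : ℚ → ℝ
fromℚ q = mkℝ (λ _ → q) λ ε 0<ε → 0 , λ _ _ _ _ →
  subst (ℚ._< ε) (sym (cong ℚ.∣_∣ (ℚ.+-inverseʳ q))) 0<ε

fromℕ : ℕ → ℝ
fromℕ n = fromℚ (+ n ℚ./ 1)

0ℝ 1ℝ : ℝ
0ℝ = fromℚ 0ℚ
1ℝ = fromℚ 1ℚ

_+_ : ℝ → ℝ → ℝ
x + y = mkℝ (λ n → seq x n ℚ.+ seq y n) λ ε 0<ε →
  let M , hx = cauchy x (½ ℚ.* ε) (0<* 0<½ 0<ε)
      N , hy = cauchy y (½ ℚ.* ε) (0<* 0<½ 0<ε)
  in M ℕ.⊔ N , λ m n m≥ n≥ → ∣+∣< (seq x m) (seq y m) (seq x n) (seq y n)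
       (hx m n (ℕ.m⊔n≤o⇒m≤o M N m≥) (ℕ.m⊔n≤o⇒m≤o M N n≥))
       (hy m n (ℕ.m⊔n≤o⇒n≤o M N m≥) (ℕ.m⊔n≤o⇒n≤o M N n≥))

-_ : ℝ → ℝ
- x = mkℝ (λ n → ℚ.- seq x n) λ ε 0<ε →
  let N , h = cauchy x ε 0<ε
  in N , λ m n m≥ n≥ →
    subst (ℚ._< ε) (cong ℚ.∣_∣ (-a--b (seq x m) (seq x n))) (h n m n≥ m≥)

_-_ : ℝ → ℝ → ℝ
x - y = x + (- y)

bounded : ∀ x → ∃[ B ] ∃[ N ] (0ℚ ℚ.< B × (∀ n → N ℕ.≤ n → ℚ.∣ seq x n ∣ ℚ.≤ B))
bounded x = let N , h = cauchy x 1ℚ 0<1 in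
    ℚ.∣ seq x N ∣ ℚ.+ 1ℚ
  , N
  , ℚ.+-mono-≤-< (ℚ.0≤∣p∣ (seq x N)) 0<1
  , λ n n≥ → ℚ.≤-trans (∣p∣≤∣q∣+∣p-q∣ (seq x n) (seq x N))
      (ℚ.+-monoʳ-≤ ℚ.∣ seq x N ∣ (ℚ.<⇒≤ (h n N n≥ ℕ.≤-refl)))

_*_ : ℝ → ℝ → ℝ
x * y = mkℝ (λ n → seq x n ℚ.* seq y n) λ ε 0<ε →
  let A , K , 0<A , hA = bounded x
      B , L , 0<B , hB = bounded y
      α , 0<α , Aα≡ = divide 0<A (0<* 0<½ 0<ε)
      β , 0<β , Bβ≡ = divide 0<B (0<* 0<½ 0<ε)
      M , hx = cauchy x β 0<β
      N , hy = cauchy y α 0<α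
  in (K ℕ.⊔ L) ℕ.⊔ (M ℕ.⊔ N) , λ m n m≥ n≥ →
    let KLm = ℕ.m⊔n≤o⇒m≤o (K ℕ.⊔ L) (M ℕ.⊔ N) m≥
        KLn = ℕ.m⊔n≤o⇒m≤o (K ℕ.⊔ L) (M ℕ.⊔ N) n≥
        MNm = ℕ.m⊔n≤o⇒n≤o (K ℕ.⊔ L) (M ℕ.⊔ N) m≥
        MNn = ℕ.m⊔n≤o⇒n≤o (K ℕ.⊔ L) (M ℕ.⊔ N) n≥
    in ∣*∣< (seq x m) (seq y m) (seq x n) (seq y n) 0<A 0<B Aα≡ Bβ≡
         (hA m (ℕ.m⊔n≤o⇒m≤o K L KLm)) (hB n (ℕ.m⊔n≤o⇒n≤o K L KLn))
         (hy m n (ℕ.m⊔n≤o⇒n≤o M N MNm) (ℕ.m⊔n≤o⇒n≤o M N MNn))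
         (hx m n (ℕ.m⊔n≤o⇒m≤o M N MNm) (ℕ.m⊔n≤o⇒m≤o M N MNn))

∣_∣ : ℝ → ℝ
∣ x ∣ = mkℝ (λ n → ℚ.∣ seq x n ∣) λ ε 0<ε →
  let N , h = cauchy x ε 0<ε
  in N , λ m n m≥ n≥ → ∣∣p∣-∣q∣∣≤∣p-q∣ (seq x m) (seq x n) (h m n m≥ n≥)

infix 4 _#0

_#0 : ℝ → Set
x #0 = ∃[ δ ] ∃[ N ] (0ℚ ℚ.< δ × (∀ n → N ℕ.≤ n → δ ℚ.≤ ℚ.∣ seq x n ∣))

recipℚ : ℚ → ℚ
recipℚ q with q ℚ.≟ 0ℚ
... | yes _  = 0ℚ
... | no q≢0 = (ℚ.1/ q) {{ℚ.≢-nonZero q≢0}}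

recipℚ-inverseʳ : ∀ {δ} q → 0ℚ ℚ.< δ → δ ℚ.≤ ℚ.∣ q ∣ → q ℚ.* recipℚ q ≡ 1ℚ
recipℚ-inverseʳ q 0<δ δ≤∣q∣ with q ℚ.≟ 0ℚ
... | yes refl = contradiction refl (ℚ.<⇒≢ (ℚ.<-≤-trans 0<δ δ≤∣q∣))
... | no q≢0   = ℚ.*-inverseʳ q {{ℚ.≢-nonZero q≢0}}

∣recip∣< : ∀ a b {δ ε} → 0ℚ ℚ.< δ → 0ℚ ℚ.< ε → δ ℚ.≤ ℚ.∣ a ∣ → δ ℚ.≤ ℚ.∣ b ∣ →
           ℚ.∣ b ℚ.- a ∣ ℚ.< ε ℚ.* (δ ℚ.* δ) → ℚ.∣ recipℚ a ℚ.- recipℚ b ∣ ℚ.< ε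
∣recip∣< a b {δ} {ε} 0<δ 0<ε δ≤a δ≤b h =
  ℚ.*-cancelˡ-<-nonNeg (ℚ.∣ a ∣ ℚ.* ℚ.∣ b ∣) {{nonNegative (ℚ.<⇒≤ (0<* 0<a 0<b))}} (begin-strict
    (ℚ.∣ a ∣ ℚ.* ℚ.∣ b ∣) ℚ.* ℚ.∣ recipℚ a ℚ.- recipℚ b ∣
      ≡⟨ cong (ℚ._* ℚ.∣ recipℚ a ℚ.- recipℚ b ∣) (sym (ℚ.∣p*q∣≡∣p∣*∣q∣ a b)) ⟩
    ℚ.∣ a ℚ.* b ∣ ℚ.* ℚ.∣ recipℚ a ℚ.- recipℚ b ∣
      ≡⟨ sym (ℚ.∣p*q∣≡∣p∣*∣q∣ (a ℚ.* b) (recipℚ a ℚ.- recipℚ b)) ⟩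
    ℚ.∣ (a ℚ.* b) ℚ.* (recipℚ a ℚ.- recipℚ b) ∣
      ≡⟨ cong ℚ.∣_∣ (trans (ab[c-d] a b (recipℚ a) (recipℚ b)) (cong₂ ℚ._-_
           (trans (cong (b ℚ.*_) (recipℚ-inverseʳ a 0<δ δ≤a)) (ℚ.*-identityʳ b))
           (trans (cong (a ℚ.*_) (recipℚ-inverseʳ b 0<δ δ≤b)) (ℚ.*-identityʳ a)))) ⟩
    ℚ.∣ b ℚ.- a ∣
      <⟨ h ⟩
    ε ℚ.* (δ ℚ.* δ)
      ≤⟨ ℚ.*-monoˡ-≤-nonNeg ε {{nonNegative (ℚ.<⇒≤ 0<ε)}}
           (ℚ.≤-trans (ℚ.*-monoˡ-≤-nonNeg δ {{nonNegative (ℚ.<⇒≤ 0<δ)}} δ≤b)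
             (ℚ.*-monoʳ-≤-nonNeg ℚ.∣ b ∣ {{nonNegative (ℚ.<⇒≤ 0<b)}} δ≤a)) ⟩
    ε ℚ.* (ℚ.∣ a ∣ ℚ.* ℚ.∣ b ∣)
      ≡⟨ ℚ.*-comm ε (ℚ.∣ a ∣ ℚ.* ℚ.∣ b ∣) ⟩
    (ℚ.∣ a ∣ ℚ.* ℚ.∣ b ∣) ℚ.* ε ∎)
  where
  open ℚ.≤-Reasoning
  0<a = ℚ.<-≤-trans 0<δ δ≤a
  0<b = ℚ.<-≤-trans 0<δ δ≤b

-- Pointwise reciprocal. Since x #0, only finitely many terms can vanish;
-- the value of recipℚ there is immaterial.
recip : (x : ℝ) → x #0 → ℝ
recip x (δ , K , 0<δ , hδ) = mkℝ (λ n → recipℚ (seq x n)) λ ε 0<ε →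
  let N , h = cauchy x (ε ℚ.* (δ ℚ.* δ)) (0<* 0<ε (0<* 0<δ 0<δ))
  in K ℕ.⊔ N , λ m n m≥ n≥ → ∣recip∣< (seq x m) (seq x n) 0<δ 0<ε
       (hδ m (ℕ.m⊔n≤o⇒m≤o K N m≥)) (hδ n (ℕ.m⊔n≤o⇒m≤o K N n≥))
       (h n m (ℕ.m⊔n≤o⇒n≤o K N n≥) (ℕ.m⊔n≤o⇒n≤o K N m≥))

-- ⌊√n⌋
isqrt : ℕ → ℕ
isqrt zero = zero
isqrt (suc n) with suc (isqrt n) ℕ.* suc (isqrt n) ℕ.≤? suc n
... | yes _ = suc (isqrt n)
... | no  _ = isqrt n

isqrt-lower : ∀ n → isqrt n ℕ.* isqrt n ℕ.≤ n
isqrt-lower zero = ℕ.z≤n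
isqrt-lower (suc n) with suc (isqrt n) ℕ.* suc (isqrt n) ℕ.≤? suc n
... | yes h = h
... | no  _ = ℕ.m≤n⇒m≤1+n (isqrt-lower n)

isqrt-upper : ∀ n → n ℕ.< suc (isqrt n) ℕ.* suc (isqrt n)
isqrt-upper zero = ℕ.s≤s ℕ.z≤n
isqrt-upper (suc n) with suc (isqrt n) ℕ.* suc (isqrt n) ℕ.≤? suc n
... | yes _ = ℕ.≤-<-trans (isqrt-upper n)
  (ℕ.*-mono-< (ℕ.n<1+n (suc (isqrt n))) (ℕ.n<1+n (suc (isqrt n))))
... | no  h = ℕ.≰⇒> h

sq-cancel-< : ∀ {a b} → a ℕ.* a ℕ.< b ℕ.* b → a ℕ.< b
sq-cancel-< {a} {b} h with a ℕ.<? b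
... | yes a<b = a<b
... | no  a≮b = contradiction h (ℕ.≤⇒≯ (ℕ.*-mono-≤ (ℕ.≮⇒≥ a≮b) (ℕ.≮⇒≥ a≮b)))

-- ⌊√(d (k+1)²)⌋ / (k+1)
√-approx : ℕ → ℕ → ℚ
√-approx d k = + isqrt (d ℕ.* (suc k ℕ.* suc k)) ℚ./ suc k

√-approx-< : ∀ d m n → √-approx d m ℚ.< √-approx d n ℚ.+ + 1 ℚ./ suc n
√-approx-< d m n =
  subst (√-approx d m ℚ.<_) (/-+ (+ s) (+ 1) n) (/-mono-< (+ r) (+ (s ℕ.+ 1)) m n
    (subst₂ ℤ._<_ (ℤ.pos-* r (suc n)) (ℤ.pos-* (s ℕ.+ 1) (suc m))
      (ℤ.+<+ (subst (λ t → r ℕ.* suc n ℕ.< t ℕ.* suc m) (ℕ.+-comm 1 s) (sq-cancel-< (begin-strict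
    (r ℕ.* suc n) ℕ.* (r ℕ.* suc n)
      ≡⟨ solve 2 (λ a b → (a :* b) :* (a :* b) := (a :* a) :* (b :* b)) refl r (suc n) ⟩
    (r ℕ.* r) ℕ.* (suc n ℕ.* suc n)
      ≤⟨ ℕ.*-monoˡ-≤ (suc n ℕ.* suc n) (isqrt-lower (d ℕ.* (suc m ℕ.* suc m))) ⟩
    (d ℕ.* (suc m ℕ.* suc m)) ℕ.* (suc n ℕ.* suc n)
      ≡⟨ solve 3 (λ a b c → (a :* b) :* c := (a :* c) :* b) refl
           d (suc m ℕ.* suc m) (suc n ℕ.* suc n) ⟩
    (d ℕ.* (suc n ℕ.* suc n)) ℕ.* (suc m ℕ.* suc m)
      <⟨ ℕ.*-monoˡ-< (suc m ℕ.* suc m) (isqrt-upper (d ℕ.* (suc n ℕ.* suc n))) ⟩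
    (suc s ℕ.* suc s) ℕ.* (suc m ℕ.* suc m)
      ≡⟨ solve 2 (λ a b → (a :* a) :* (b :* b) := (a :* b) :* (a :* b)) refl (suc s) (suc m) ⟩
    (suc s ℕ.* suc m) ℕ.* (suc s ℕ.* suc m) ∎))))))
  where
  open ℕ.≤-Reasoning
  open ℕS
  r s : ℕ
  r = isqrt (d ℕ.* (suc m ℕ.* suc m))
  s = isqrt (d ℕ.* (suc n ℕ.* suc n))

√_ : ℕ → ℝ
√ d = mkℝ (√-approx d) λ ε 0<ε →
  let N , h = archimedean ε 0<ε
  in N , λ m n m≥ n≥ → ∣p∣<
    (ℚ.<-trans (p-q<r (√-approx-< d m n)) (h n n≥))
    (subst (ℚ._< ε) (b-a (√-approx d m) (√-approx d n))
      (ℚ.<-trans (p-q<r (√-approx-< d n m)) (h m m≥)))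

√-#0 : ∀ d → .{{NonZero d}} → √ d #0
√-#0 d@(suc d-1) = 1ℚ , 0 , 0<1 , λ k _ →
  ℚ.≤-trans (/-mono-≤ (+ 1) (+ r k) 0 k (subst₂ ℤ._≤_ (ℤ.pos-* 1 (suc k)) (ℤ.pos-* (r k) 1)
    (ℤ.+≤+ (subst₂ ℕ._≤_ (sym (ℕ.*-identityˡ (suc k))) (sym (ℕ.*-identityʳ (r k)))
      (ℕ.s≤s⁻¹ (sq-cancel-< (ℕ.≤-<-trans
        (ℕ.m≤m+n (suc k ℕ.* suc k) (d-1 ℕ.* (suc k ℕ.* suc k)))
        (isqrt-upper (d ℕ.* (suc k ℕ.* suc k))))))))))
    (p≤∣p∣ (√-approx d k))
  where
  r : ℕ → ℕ
  r k = isqrt (d ℕ.* (suc k ℕ.* suc k))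

1/√ : (d : ℕ) → .{{NonZero d}} → ℝ
1/√ d = recip (√ d) (√-#0 d)

ℝ-rawRing : RawRing 0ℓ 0ℓ
ℝ-rawRing = record
  { Carrier = ℝ ; _≈_ = _≈_ ; _+_ = _+_ ; _*_ = _*_ ; -_ = -_ ; 0# = 0ℝ ; 1# = 1ℝ }

open RawSemiringDefs (RawRing.rawSemiring ℝ-rawRing) public using (sum; product; _^_)

Matrix : ℕ → Set
Matrix n = Fin n → Fin n → ℝ

identity : ∀ {n} → Matrix n
identity i j = if does (i Fin.≟ j) then 1ℝ else 0ℝ

-- Laplace expansion along the first row
det : ∀ {n} → Matrix n → ℝ
det {zero}  A = 1ℝ
det {suc n} A = sum λ j →
  ((- 1ℝ) ^ toℕ j) * (A zero j * det (λ i k → A (suc i) (punchIn j k)))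

charPoly : ∀ {n} → Matrix n → ℝ → ℝ
charPoly A x = det (λ i j → x * identity i j - A i j)

-- ρ lists the eigenvalues of A with (algebraic) multiplicity.
IsSpectrum : ∀ {n} → Matrix n → Vector ℝ n → Set
IsSpectrum A ρ = ∀ x → charPoly A x ≈ product (λ i → x - ρ i)

record Graph : Set₁ where
  infix 4 _~_ _~?_
  field
    order    : ℕ
    _~_      : Rel (Fin order) 0ℓ
    _~?_     : Decidable _~_
    ~-sym    : Symmetric _~_
    ~-irrefl : ∀ i → ¬ i ~ i

  degree : Fin order → ℕ
  degree i = length (filter (i ~?_) (allFin order))

  degree-nonZero : ∀ {i j} → i ~ j → NonZero (degree i)
  degree-nonZero {i} {j} i~j = ℕ.>-nonZero (filter-some (i ~?_) (lose (∈-allFin j) i~j))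

randićMatrix : (G : Graph) → Matrix (Graph.order G)
randićMatrix G i j with Graph._~?_ G i j
... | yes i~j = 1/√ (degree i ℕ.* degree j)
  {{ℕ.m*n≢0 (degree i) (degree j) {{degree-nonZero i~j}} {{degree-nonZero (~-sym i~j)}}}}
  where open Graph G
... | no  _   = 0ℝ

RP : Graph → ℝ → ℝ
RP G = charPoly (randićMatrix G)

-- "The energy of G exists and equals e": a list of eigenvalues exists,
-- and every such list has absolute values summing to e.
RE_≈_ : Graph → ℝ → Set
RE G ≈ e = ∃ (IsSpectrum (randićMatrix G)) ×
  (∀ ρ → IsSpectrum (randićMatrix G) ρ → sum (λ i → ∣ ρ i ∣) ≈ e)

-- K p q, with parts {0,…,p-1} and {p,…,p+q-1}
K : ℕ → ℕ → Graph
K p q = record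
  { order    = p ℕ.+ q
  ; _~_      = λ i j → (toℕ i ℕ.< p × p ℕ.≤ toℕ j) ⊎ (p ℕ.≤ toℕ i × toℕ j ℕ.< p)
  ; _~?_     = λ i j → (toℕ i ℕ.<? p ×-dec p ℕ.≤? toℕ j) ⊎-dec (p ℕ.≤? toℕ i ×-dec toℕ j ℕ.<? p)
  ; ~-sym    = λ { (inj₁ (i<p , p≤j)) → inj₂ (p≤j , i<p) ; (inj₂ (p≤i , j<p)) → inj₁ (j<p , p≤i) }
  ; ~-irrefl = λ { i (inj₁ (i<p , p≤i)) → ℕ.<⇒≱ i<p p≤i ; i (inj₂ (p≤i , i<p)) → ℕ.<⇒≱ i<p p≤i }
  }

star : ℕ → Graph
star n = K 1 (n ℕ.∸ 1)

{-# OPTIONS --safe #-}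

-- The matrix λI - R(Sₙ) is an arrowhead matrix, λ on the diagonal and -c along
-- the border with c² = 1/(n-1); expanding along the first row gives
-- λⁿ⁻²(λ² - (n-1)c²) = λⁿ⁻²(λ² - 1).
-- Every eigenvalue is a root of this polynomial, hence 0, 1 or -1. Evaluating
-- ∏(λ - ρᵢ) = λⁿ⁻²(λ² - 1) at λ = 2 and comparing powers of 2 shows that exactly
-- n-2 of them are 0, so the remaining two contribute |±1| each to the energy.
-- The case distinction on eigenvalues is not decidable, but equality of reals is
-- ¬¬-stable, so it may be made under a double negation.
module Submission where

open import Algebra.Bundles using (CommutativeRing; Semiring)
import Algebra.Definitions.RawSemiring
import Algebra.Properties.CommutativeSemigroup
import Algebra.Properties.Ring
import Algebra.Properties.Semiring.Exp
import Algebra.Properties.Semiring.Sum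
open import Data.Bool.Base using (if_then_else_)
import Data.Bool.Properties as Bool
open import Data.Fin.Base using (Fin; zero; suc; toℕ; punchIn)
import Data.Fin.Properties as Fin
open import Data.Integer.Base using (+_)
import Data.Integer.Base as ℤ
import Data.Integer.Properties as ℤ
open import Data.List.Base using (length)
open import Data.List.Properties using (filter-all; filter-none; length-tabulate)
import Data.List.Relation.Unary.All.Properties as All
open import Data.Nat.Base as ℕ using (ℕ; zero; suc; NonZero; _≤_; _∸_)
open import Data.Nat.Divisibility using (_∣_; _∤_; _∣?_; m∣m*n)
open import Data.Nat.Primality using (euclidsLemma; prime[2])
import Data.Nat.Properties as ℕ
open import Data.Product.Base using (∃-syntax; _×_; _,_; proj₁; proj₂)
open import Data.Rational.Base as ℚ using (ℚ; 0ℚ; 1ℚ; ½)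
import Data.Rational.Properties as ℚ
open import Data.Rational.Solver using (module +-*-Solver)
import Data.Rational.Unnormalised.Base as ℚᵘ
import Data.Rational.Unnormalised.Properties as ℚᵘ
open import Data.Sum.Base using (_⊎_; inj₁; inj₂; [_,_]′)
open import Data.Vec.Functional using (Vector; _∷_)
open import Effect.Monad using (RawMonad)
open import Function.Base using (id)
open import Relation.Binary.Bundles using (Setoid)
import Relation.Binary.Reasoning.Setoid
open import Relation.Nullary using (¬_; Dec; yes; no; does; contradiction; from-no)
open import Relation.Nullary.Negation using (¬¬-Monad; ¬¬-map)

-- Determinants of arrowhead matrices over a commutative ring

module Determinant {a ℓ} (R : CommutativeRing a ℓ) where

  open CommutativeRing R hiding (zero)
  open Algebra.Properties.Ring ring using (-1*x≈-x; -‿involutive)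
  open Algebra.Properties.CommutativeSemigroup *-commutativeSemigroup using (x∙yz≈y∙xz; interchange)
  open Algebra.Properties.Semiring.Exp semiring public using (_^_)
  open Algebra.Properties.Semiring.Sum semiring public using (sum; sum-cong-≋; sum-replicate-zero; *-distribʳ-sum)
  open Algebra.Definitions.RawSemiring (Semiring.rawSemiring semiring) public using (product)
  open Relation.Binary.Reasoning.Setoid setoid

  Matrix : ℕ → Set a
  Matrix n = Fin n → Fin n → Carrier

  δ : ∀ {n} → Matrix n
  δ i j = if does (i Fin.≟ j) then 1# else 0#

  det : ∀ {n} → Matrix n → Carrier
  det {zero}  A = 1#
  det {suc n} A = sum λ j →
    ((- 1#) ^ toℕ j) * (A zero j * det (λ i k → A (suc i) (punchIn j k)))

  sum-zero : ∀ {n} (v : Vector Carrier n) → (∀ i → v i ≈ 0#) → sum v ≈ 0#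
  sum-zero {n} v v≈0 = trans (sum-cong-≋ v≈0) (sum-replicate-zero n)

  product-cong : ∀ {n} {u v : Vector Carrier n} → (∀ i → u i ≈ v i) → product u ≈ product v
  product-cong {zero}  u≈v = refl
  product-cong {suc n} u≈v = *-cong (u≈v zero) (product-cong λ i → u≈v (suc i))

  product-replicate : ∀ n x → product {n} (λ _ → x) ≈ x ^ n
  product-replicate zero    x = refl
  product-replicate (suc n) x = *-congˡ (product-replicate n x)

  product-zero : ∀ {n} {v : Vector Carrier n} i → v i ≈ 0# → product v ≈ 0#
  product-zero zero    vᵢ≈0 = trans (*-congʳ vᵢ≈0) (zeroˡ _)
  product-zero (suc i) vᵢ≈0 = trans (*-congˡ (product-zero i vᵢ≈0)) (zeroʳ _)

  det-cong : ∀ {n} {A B : Matrix n} → (∀ i j → A i j ≈ B i j) → det A ≈ det B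
  det-cong {zero}  A≈B = refl
  det-cong {suc n} A≈B = sum-cong-≋ λ j →
    *-congˡ {(- 1#) ^ toℕ j} (*-cong (A≈B zero j) (det-cong λ i k → A≈B (suc i) (punchIn j k)))

  zero-entry : ∀ s {e} d → e ≈ 0# → s * (e * d) ≈ 0#
  zero-entry s d e≈0 = trans (*-congˡ (trans (*-congʳ e≈0) (zeroˡ d))) (zeroʳ s)

  zero-minor : ∀ s e {d} → d ≈ 0# → s * (e * d) ≈ 0#
  zero-minor s e d≈0 = trans (*-congˡ (trans (*-congˡ d≈0) (zeroʳ e))) (zeroʳ s)

  -- In the expansion along the first row, the term at column zero dies with its entry. Every other
  -- minor keeps column zero in front, since `punchIn (suc j) zero` is `zero`, so it vanishes by
  -- induction.
  det-zero-column : ∀ {n} (A : Matrix (suc n)) → (∀ i → A i zero ≈ 0#) → det A ≈ 0#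
  det-zero-column {n} A Aᵢ₀≈0 = sum-zero _ (go A Aᵢ₀≈0)
    where
    go : ∀ {n} (A : Matrix (suc n)) → (∀ i → A i zero ≈ 0#) → ∀ j →
         ((- 1#) ^ toℕ j) * (A zero j * det (λ i k → A (suc i) (punchIn j k))) ≈ 0#
    go         A Aᵢ₀≈0 zero    = zero-entry _ _ (Aᵢ₀≈0 zero)
    go {suc n} A Aᵢ₀≈0 (suc j) = zero-minor ((- 1#) ^ toℕ (suc j)) (A zero (suc j))
      (det-zero-column (λ i k → A (suc i) (punchIn (suc j) k)) λ i → Aᵢ₀≈0 (suc i))

  det-zero-row : ∀ {n} (A : Matrix (suc n)) → (∀ j → A zero (suc j) ≈ 0#) →
                 det A ≈ A zero zero * det (λ i k → A (suc i) (suc k))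
  det-zero-row {n} A A₀ⱼ≈0 = begin
    det A
      ≈⟨ +-cong (*-identityˡ _) (sum-zero {n} _ λ j →
           zero-entry (- 1# * (- 1#) ^ toℕ j) (det λ i k → A (suc i) (punchIn (suc j) k)) (A₀ⱼ≈0 j)) ⟩
    A zero zero * det (λ i k → A (suc i) (suc k)) + 0#
      ≈⟨ +-identityʳ _ ⟩
    A zero zero * det (λ i k → A (suc i) (suc k)) ∎

  det-scalar : ∀ n x → det {n} (λ i j → x * δ i j) ≈ x ^ n
  det-scalar zero    x = refl
  det-scalar (suc n) x = trans (det-zero-row {n} (λ i j → x * δ i j) λ _ → zeroʳ x)
    (*-cong (*-identityʳ x) (det-scalar n x))

  -- The minor of `arrow` obtained by deleting row zero and column `suc j`: a column of `c` followed
  -- by a scalar matrix that has lost column `j`. It is defined separately so that its determinant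
  -- can be found by induction on `j`.
  bordered : ∀ {m} → Carrier → Carrier → Fin (suc m) → Matrix (suc m)
  bordered x c j i zero    = c
  bordered x c j i (suc k) = x * δ i (punchIn j k)

  -- For `j = zero` the first row is `c` followed by zeros and the remaining block is scalar. For
  -- `suc j` the first row is `c, x, 0, ...`: the minor of `c` has a zero first column, and the
  -- minor of `x` is the same kind of matrix for `j`, so each step contributes a sign and a factor
  -- `x`.
  det-bordered : ∀ {m} x c (j : Fin (suc m)) →
                 det (bordered x c j) ≈ ((- 1#) ^ toℕ j) * (c * (x ^ m))
  det-bordered {m} x c zero = begin
    det (bordered {m} x c zero)    ≈⟨ det-zero-row (bordered {m} x c zero) (λ _ → zeroʳ x) ⟩
    c * det {m} (λ i k → x * δ i k) ≈⟨ *-congˡ (det-scalar m x) ⟩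
    c * (x ^ m)                     ≈⟨ *-identityˡ _ ⟨
    1# * (c * (x ^ m))              ∎
  det-bordered {suc m} x c (suc j) = begin
    det (bordered {suc m} x c (suc j))
      ≈⟨ +-cong
           (zero-minor 1# c (det-zero-column {m} (λ i k → x * δ (suc i) (punchIn (suc j) k))
             λ _ → zeroʳ x))
           (+-cong
             (*-congˡ (*-cong (*-identityʳ x)
               (trans (det-cong second-minor) (det-bordered {m} x c j))))
             (sum-zero {m} _ λ _ → zero-entry _ _ (zeroʳ x))) ⟩
    0# + (ε * 1# * (x * (ε ^ toℕ j * (c * (x ^ m)))) + 0#)
      ≈⟨ trans (+-identityˡ _) (+-identityʳ _) ⟩
    ε * 1# * (x * (ε ^ toℕ j * (c * (x ^ m))))
      ≈⟨ *-cong (*-identityʳ ε) (trans (x∙yz≈y∙xz x _ _) (*-congˡ (x∙yz≈y∙xz x c _))) ⟩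
    ε * (ε ^ toℕ j * (c * (x * x ^ m)))
      ≈⟨ *-assoc ε _ _ ⟨
    ε * ε ^ toℕ j * (c * (x * x ^ m)) ∎
    where
    ε = - 1#
    second-minor : ∀ i k → bordered x c (suc j) (suc i) (punchIn (suc zero) k) ≈ bordered x c j i k
    second-minor i zero    = refl
    second-minor i (suc k) = refl

  arrow : ∀ {n} → Carrier → Carrier → Matrix (suc n)
  arrow x c zero    zero    = x
  arrow x c zero    (suc j) = c
  arrow x c (suc i) zero    = c
  arrow x c (suc i) (suc j) = x * δ i j

  -1^n*-1^n≈1 : ∀ n → (- 1#) ^ n * (- 1#) ^ n ≈ 1#
  -1^n*-1^n≈1 zero    = *-identityˡ 1#
  -1^n*-1^n≈1 (suc n) = begin
    ε * ε ^ n * (ε * ε ^ n)   ≈⟨ interchange ε _ ε _ ⟩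
    ε * ε * (ε ^ n * ε ^ n)   ≈⟨ *-cong (trans (-1*x≈-x ε) (-‿involutive 1#)) (-1^n*-1^n≈1 n) ⟩
    1# * 1#                   ≈⟨ *-identityˡ 1# ⟩
    1#                        ∎
    where ε = - 1#

  -- The corner entry gives `x` times a scalar determinant. For a border entry the cofactor sign has
  -- exponent one larger than the sign in `det-bordered`, so the signs always multiply to -1 and
  -- every border term is the same.
  det-arrow : ∀ m x c →
              det (arrow {suc m} x c) ≈ (x ^ m) * ((x ^ 2) - sum {suc m} (λ _ → c * c))
  det-arrow m x c = begin
    det (arrow {suc m} x c)
      ≈⟨ +-cong
           (trans (*-identityˡ _) (*-congˡ (det-scalar (suc m) x)))
           (sum-cong-≋ {suc m} λ j → *-congˡ {ε * ε ^ toℕ j} (*-congˡ {c}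
             (trans (det-cong (minor j)) (det-bordered x c j)))) ⟩
    x * (x * x ^ m) + sum (λ (j : Fin (suc m)) → ε * ε ^ toℕ j * (c * (ε ^ toℕ j * (c * x ^ m))))
      ≈⟨ +-congˡ (sum-cong-≋ {suc m} λ j → term (toℕ j)) ⟩
    x * (x * x ^ m) + sum {suc m} (λ _ → c * c * (ε * x ^ m))
      ≈⟨ +-congˡ (*-distribʳ-sum {suc m} (ε * x ^ m) (λ _ → c * c)) ⟨
    x * (x * x ^ m) + ∑c² * (ε * x ^ m)
      ≈⟨ +-cong (sym (*-assoc x x _)) (sym (*-assoc ∑c² ε _)) ⟩
    x * x * x ^ m + ∑c² * ε * x ^ m
      ≈⟨ distribʳ (x ^ m) (x * x) (∑c² * ε) ⟨
    (x * x + ∑c² * ε) * x ^ m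
      ≈⟨ *-comm _ _ ⟩
    x ^ m * (x * x + ∑c² * ε)
      ≈⟨ *-congˡ (+-cong (*-congˡ (sym (*-identityʳ x))) (trans (*-comm ∑c² ε) (-1*x≈-x ∑c²))) ⟩
    x ^ m * (x ^ 2 - ∑c²) ∎
    where
    ε = - 1#
    ∑c² = sum {suc m} (λ _ → c * c)
    minor : ∀ j i k → arrow {suc m} x c (suc i) (punchIn (suc j) k) ≈ bordered x c j i k
    minor j i zero    = refl
    minor j i (suc k) = refl
    term : ∀ k → ε * ε ^ k * (c * (ε ^ k * (c * x ^ m))) ≈ c * c * (ε * x ^ m)
    term k = begin
      ε * ε ^ k * (c * (ε ^ k * (c * x ^ m)))
        ≈⟨ *-congˡ (x∙yz≈y∙xz c _ _) ⟩
      ε * ε ^ k * (ε ^ k * (c * (c * x ^ m)))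
        ≈⟨ trans (*-assoc ε _ _) (*-congˡ (sym (*-assoc _ _ _))) ⟩
      ε * (ε ^ k * ε ^ k * (c * (c * x ^ m)))
        ≈⟨ *-congˡ (trans (*-congʳ (-1^n*-1^n≈1 k)) (*-identityˡ _)) ⟩
      ε * (c * (c * x ^ m))
        ≈⟨ *-congˡ (*-assoc c c _) ⟨
      ε * (c * c * x ^ m)
        ≈⟨ x∙yz≈y∙xz ε _ _ ⟩
      c * c * (ε * x ^ m) ∎

open import Defs
open import Relation.Binary.PropositionalEquality using (_≡_; refl; sym; trans; cong; cong₂; subst; subst₂)

open ℚ-Lemmas
open Algebra.Properties.CommutativeSemigroup ℕ.*-commutativeSemigroup using (x∙yz≈y∙xz)

-- Reals as Cauchy sequences

-- Operations on ℝ act termwise, so ring identities are inherited from ℚ.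
pointwise : ∀ x y → (∀ n → seq x n ≡ seq y n) → x ≈ y
pointwise x y e ε 0<ε = 0 , λ n _ → subst (ℚ._< ε)
  (sym (cong ℚ.∣_∣ (trans (cong (ℚ._- seq y n) (e n)) (ℚ.+-inverseʳ (seq y n))))) 0<ε

-- _≈_ unfolds to its ε-N definition, from which Agda cannot recover the two reals:
-- hence the explicit arguments.
≈-refl : ∀ x → x ≈ x
≈-refl x = pointwise x x λ _ → refl

≈-sym : ∀ x y → x ≈ y → y ≈ x
≈-sym x y h ε 0<ε = let N , hN = h ε 0<ε in N , λ n n≥ →
  subst (ℚ._< ε) (∣p-q∣≡∣q-p∣ (seq x n) (seq y n)) (hN n n≥)

≈-trans : ∀ x y z → x ≈ y → y ≈ z → x ≈ z
≈-trans x y z h k ε 0<ε =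
  let M , hM = h (½ ℚ.* ε) (0<* 0<½ 0<ε)
      N , kN = k (½ ℚ.* ε) (0<* 0<½ 0<ε)
  in M ℕ.⊔ N , λ n n≥ → subst (ℚ._< ε)
       (cong ℚ.∣_∣ (solve 3 (λ a b c → (a :+ b) :- (b :+ c) := a :- c) refl (seq x n) (seq y n) (seq z n)))
       (∣+∣< (seq x n) (seq y n) (seq y n) (seq z n)
         (hM n (ℕ.m⊔n≤o⇒m≤o M N n≥)) (kN n (ℕ.m⊔n≤o⇒n≤o M N n≥)))
  where open +-*-Solver

+-cong : ∀ x y u v → x ≈ y → u ≈ v → x + u ≈ y + v
+-cong x y u v h k ε 0<ε =
  let M , hM = h (½ ℚ.* ε) (0<* 0<½ 0<ε)
      N , kN = k (½ ℚ.* ε) (0<* 0<½ 0<ε)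
  in M ℕ.⊔ N , λ n n≥ → ∣+∣< (seq x n) (seq u n) (seq y n) (seq v n)
       (hM n (ℕ.m⊔n≤o⇒m≤o M N n≥)) (kN n (ℕ.m⊔n≤o⇒n≤o M N n≥))

-‿cong : ∀ x y → x ≈ y → - x ≈ - y
-‿cong x y h ε 0<ε = let N , hN = h ε 0<ε in N , λ n n≥ →
  subst (ℚ._< ε)
    (trans (∣p-q∣≡∣q-p∣ (seq x n) (seq y n)) (cong ℚ.∣_∣ (-a--b (seq x n) (seq y n))))
    (hN n n≥)

*-cong : ∀ x y u v → x ≈ y → u ≈ v → x * u ≈ y * v
*-cong x y u v h k ε 0<ε =
  let A , K , 0<A , hA = bounded x
      B , L , 0<B , hB = bounded v
      α , 0<α , Aα≡ = divide 0<A (0<* 0<½ 0<ε)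
      β , 0<β , Bβ≡ = divide 0<B (0<* 0<½ 0<ε)
      M , hM = h β 0<β
      N , kN = k α 0<α
  in (K ℕ.⊔ L) ℕ.⊔ (M ℕ.⊔ N) , λ n n≥ →
    let KL = ℕ.m⊔n≤o⇒m≤o (K ℕ.⊔ L) (M ℕ.⊔ N) n≥
        MN = ℕ.m⊔n≤o⇒n≤o (K ℕ.⊔ L) (M ℕ.⊔ N) n≥
    in ∣*∣< (seq x n) (seq u n) (seq y n) (seq v n) 0<A 0<B Aα≡ Bβ≡
         (hA n (ℕ.m⊔n≤o⇒m≤o K L KL)) (hB n (ℕ.m⊔n≤o⇒n≤o K L KL))
         (kN n (ℕ.m⊔n≤o⇒n≤o M N MN)) (hM n (ℕ.m⊔n≤o⇒m≤o M N MN))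

∣∣-cong : ∀ x y → x ≈ y → ∣ x ∣ ≈ ∣ y ∣
∣∣-cong x y h ε 0<ε = let N , hN = h ε 0<ε in N , λ n n≥ →
  ∣∣p∣-∣q∣∣≤∣p-q∣ (seq x n) (seq y n) (hN n n≥)

ℝ-setoid : Setoid _ _
ℝ-setoid = record
  { Carrier = ℝ ; _≈_ = _≈_
  ; isEquivalence = record
    { refl  = λ {x} → ≈-refl x
    ; sym   = λ {x} {y} → ≈-sym x y
    ; trans = λ {x} {y} {z} → ≈-trans x y z
    }
  }

open Relation.Binary.Reasoning.Setoid ℝ-setoid

-- Rational constants, square roots and reciprocals in ℝ

/-* : ∀ i j c d → (i ℚ./ suc c) ℚ.* (j ℚ./ suc d) ≡ (i ℤ.* j) ℚ./ (suc c ℕ.* suc d)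
/-* i j c d = ℚ.toℚᵘ-injective (ℚᵘ.≃-trans (ℚ.toℚᵘ-homo-* (i ℚ./ suc c) (j ℚ./ suc d))
  (ℚᵘ.≃-trans
    (ℚᵘ.*-cong (ℚ.toℚᵘ-fromℚᵘ (ℚᵘ.mkℚᵘ i c)) (ℚ.toℚᵘ-fromℚᵘ (ℚᵘ.mkℚᵘ j d)))
    (ℚᵘ.≃-sym (ℚ.toℚᵘ-fromℚᵘ (ℚᵘ.mkℚᵘ i c ℚᵘ.* ℚᵘ.mkℚᵘ j d)))))

fromℕ-+ : ∀ m n → fromℕ m + fromℕ n ≈ fromℕ (m ℕ.+ n)
fromℕ-+ m n = pointwise (fromℕ m + fromℕ n) (fromℕ (m ℕ.+ n)) λ _ → sym (/-+ (+ m) (+ n) 0)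

/1-* : ∀ m n → + (m ℕ.* n) ℚ./ 1 ≡ (+ m ℚ./ 1) ℚ.* (+ n ℚ./ 1)
/1-* m n = trans (cong (ℚ._/ 1) (ℤ.pos-* m n)) (sym (/-* (+ m) (+ n) 0 0))

fromℕ-* : ∀ m n → fromℕ m * fromℕ n ≈ fromℕ (m ℕ.* n)
fromℕ-* m n = pointwise (fromℕ m * fromℕ n) (fromℕ (m ℕ.* n)) λ _ → sym (/1-* m n)

-- For constant sequences, closeness at ε = `ℚ.∣ p ℚ.- q ∣` would make this number less than itself.
fromℚ-injective : ∀ p q → fromℚ p ≈ fromℚ q → p ≡ q
fromℚ-injective p q h with p ℚ.≟ q
... | yes p≡q = p≡q
... | no  p≢q = contradiction (proj₂ (h ℚ.∣ p ℚ.- q ∣ 0<∣p-q∣) _ ℕ.≤-refl) (ℚ.<-irrefl refl)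
  where
  0<∣p-q∣ : 0ℚ ℚ.< ℚ.∣ p ℚ.- q ∣
  0<∣p-q∣ = ℚ.≰⇒> λ h → p≢q (trans
    (solve 2 (λ a b → a := (a :- b) :+ b) refl p q)
    (trans (cong (ℚ._+ q) (ℚ.∣p∣≡0⇒p≡0 (p ℚ.- q) (ℚ.≤-antisym h (ℚ.0≤∣p∣ (p ℚ.- q))))) (ℚ.+-identityˡ q)))
    where open +-*-Solver

fromℕ-injective : ∀ m n → fromℕ m ≈ fromℕ n → m ≡ n
fromℕ-injective m n h
  with ℚ./-injective-≃ (ℚᵘ.mkℚᵘ (+ m) 0) (ℚᵘ.mkℚᵘ (+ n) 0) (fromℚ-injective (+ m ℚ./ 1) (+ n ℚ./ 1) h)
... | ℚᵘ.*≡* e = ℤ.+-injective (trans (sym (ℤ.*-identityʳ (+ m))) (trans e (ℤ.*-identityʳ (+ n))))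

-- At every index `z` is no further from `x` than `y` is, so the same `N` works.
squeeze : ∀ x y z → (∀ n → seq x n ℚ.≤ seq z n) → (∀ n → seq z n ℚ.≤ seq y n) → x ≈ y → x ≈ z
squeeze x y z x≤z z≤y h ε 0<ε = let N , hN = h ε 0<ε in N , λ n n≥ → ℚ.≤-<-trans
  (subst₂ ℚ._≤_ (abs (x≤z n)) (abs (ℚ.≤-trans (x≤z n) (z≤y n)))
    (ℚ.+-monoˡ-≤ (ℚ.- seq x n) (z≤y n)))
  (hN n n≥)
  where
  abs : ∀ {p q} → p ℚ.≤ q → q ℚ.- p ≡ ℚ.∣ p ℚ.- q ∣
  abs {p} {q} p≤q = trans (sym (ℚ.0≤p⇒∣p∣≡p 0≤q-p)) (∣p-q∣≡∣q-p∣ q p)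
    where
    0≤q-p : 0ℚ ℚ.≤ q ℚ.- p
    0≤q-p = subst (ℚ._≤ q ℚ.- p) (ℚ.+-inverseʳ p) (ℚ.+-monoˡ-≤ (ℚ.- p) p≤q)

-- The rounding error of the floor approximations to a square root, made into a real number so that
-- the upper bound on `d` becomes the square of a real equal to `√ d`.
1/suc : ℝ
1/suc = mkℝ (λ n → + 1 ℚ./ suc n) λ ε 0<ε →
  let N , h = archimedean (½ ℚ.* ε) (0<* 0<½ 0<ε)
      ∣p∣<½ε : ∀ n → N ℕ.≤ n → ℚ.∣ + 1 ℚ./ suc n ∣ ℚ.< ½ ℚ.* ε
      ∣p∣<½ε n n≥ = subst (ℚ._< ½ ℚ.* ε) (sym (ℚ.0≤p⇒∣p∣≡p (0≤1/suc n))) (h n n≥)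
  in N , λ m n m≥ n≥ → ℚ.≤-<-trans (ℚ.∣p-q∣≤∣p∣+∣q∣ (+ 1 ℚ./ suc m) (+ 1 ℚ./ suc n))
    (subst (_ ℚ.<_) (½ε+½ε≡ε ε) (ℚ.+-mono-< (∣p∣<½ε m m≥) (∣p∣<½ε n n≥)))
  where
  0≤1/suc : ∀ n → 0ℚ ℚ.≤ + 1 ℚ./ suc n
  0≤1/suc n = ℚ.nonNegative⁻¹ (+ 1 ℚ./ suc n) {{ℚ.normalize-nonNeg 1 (suc n)}}

1/suc≈0 : 1/suc ≈ 0ℝ
1/suc≈0 ε 0<ε = let N , h = archimedean ε 0<ε in N , λ n n≥ →
  subst (ℚ._< ε) (sym (trans (cong ℚ.∣_∣ (ℚ.+-identityʳ (+ 1 ℚ./ suc n)))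
    (ℚ.0≤p⇒∣p∣≡p (ℚ.nonNegative⁻¹ (+ 1 ℚ./ suc n) {{ℚ.normalize-nonNeg 1 (suc n)}})))) (h n n≥)

√-approx-lower : ∀ d k → √-approx d k ℚ.* √-approx d k ℚ.≤ + d ℚ./ 1
√-approx-lower d k = subst (ℚ._≤ + d ℚ./ 1) (sym (/-* (+ r) (+ r) k k))
  (/-mono-≤ (+ r ℤ.* + r) (+ d) _ 0 (subst₂ ℤ._≤_
    (trans (ℤ.pos-* r r) (sym (ℤ.*-identityʳ (+ r ℤ.* + r)))) (ℤ.pos-* d (suc k ℕ.* suc k))
    (ℤ.+≤+ (isqrt-lower (d ℕ.* (suc k ℕ.* suc k))))))
  where r = isqrt (d ℕ.* (suc k ℕ.* suc k))

√-approx-upper : ∀ d k → + d ℚ./ 1 ℚ.≤ (√-approx d k ℚ.+ + 1 ℚ./ suc k) ℚ.* (√-approx d k ℚ.+ + 1 ℚ./ suc k)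
√-approx-upper d k = subst (λ t → + d ℚ./ 1 ℚ.≤ t ℚ.* t) (/-+ (+ r) (+ 1) k)
  (subst (+ d ℚ./ 1 ℚ.≤_) (sym (/-* (+ (r ℕ.+ 1)) (+ (r ℕ.+ 1)) k k))
    (/-mono-≤ (+ d) (+ (r ℕ.+ 1) ℤ.* + (r ℕ.+ 1)) 0 _ (subst₂ ℤ._≤_
      (ℤ.pos-* d (suc k ℕ.* suc k))
      (trans (ℤ.pos-* (r ℕ.+ 1) (r ℕ.+ 1)) (sym (ℤ.*-identityʳ (+ (r ℕ.+ 1) ℤ.* + (r ℕ.+ 1)))))
      (ℤ.+≤+ (subst (λ t → d ℕ.* (suc k ℕ.* suc k) ℕ.≤ t ℕ.* t) (ℕ.+-comm 1 r)
        (ℕ.<⇒≤ (isqrt-upper (d ℕ.* (suc k ℕ.* suc k)))))))))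
  where r = isqrt (d ℕ.* (suc k ℕ.* suc k))

-- The floor bounds give s² ≤ d ≤ (s + 1/(k+1))² for the k-th approximation s.
√d*√d≈d : ∀ d → √ d * √ d ≈ fromℕ d
√d*√d≈d d = squeeze (√ d * √ d) (t * t) (fromℕ d) (√-approx-lower d) (√-approx-upper d)
  (*-cong (√ d) t (√ d) t √d≈t √d≈t)
  where
  t = √ d + 1/suc
  √d≈t : √ d ≈ t
  √d≈t = begin
    √ d         ≈⟨ pointwise (√ d) (√ d + 0ℝ) (λ n → sym (ℚ.+-identityʳ (√-approx d n))) ⟩
    √ d + 0ℝ    ≈⟨ +-cong (√ d) (√ d) 0ℝ 1/suc (≈-refl (√ d)) (≈-sym 1/suc 0ℝ 1/suc≈0) ⟩
    √ d + 1/suc ∎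

x*recip≈1 : ∀ x (x#0 : x #0) → x * recip x x#0 ≈ 1ℝ
-- From index `K` on no term vanishes, so the products are exactly 1 and `K` serves every ε.
x*recip≈1 x x#0@(δ , K , 0<δ , hδ) ε 0<ε = K , λ n n≥ → subst (ℚ._< ε)
  (sym (cong (λ p → ℚ.∣ p ℚ.- 1ℚ ∣) (recipℚ-inverseʳ (seq x n) 0<δ (hδ n n≥)))) 0<ε

-- The multiplied-out form matches `sum-const`: the `d` border entries of the star contribute `d`
-- equal squares with total 1.
1/√-square : ∀ d .{{_ : NonZero d}} → fromℕ d * (1/√ d * 1/√ d) ≈ 1ℝ
1/√-square d = begin
  fromℕ d * (r * r)    ≈⟨ *-cong (fromℕ d) (√ d * √ d) (r * r) (r * r)
                            (≈-sym (√ d * √ d) (fromℕ d) (√d*√d≈d d)) (≈-refl (r * r)) ⟩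
  √ d * √ d * (r * r)  ≈⟨ pointwise (√ d * √ d * (r * r)) (√ d * r * (√ d * r)) (λ n →
                            solve 2 (λ a b → a :* a :* (b :* b) := a :* b :* (a :* b)) refl
                              (seq (√ d) n) (seq r n)) ⟩
  √ d * r * (√ d * r)  ≈⟨ *-cong (√ d * r) 1ℝ (√ d * r) 1ℝ √d*r≈1 √d*r≈1 ⟩
  1ℝ * 1ℝ              ≈⟨ pointwise (1ℝ * 1ℝ) 1ℝ (λ _ → refl) ⟩
  1ℝ                   ∎
  where
  open +-*-Solver
  r = 1/√ d
  √d*r≈1 : √ d * r ≈ 1ℝ
  √d*r≈1 = x*recip≈1 (√ d) (√-#0 d)

-- The characteristic polynomial

module Q = Determinant ℚ.+-*-commutativeRing

-- Taking the k-th term is a ring homomorphism to ℚ, so it commutes with det.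
seq-^ : ∀ x m k → seq (x ^ m) k ≡ seq x k Q.^ m
seq-^ x zero    k = refl
seq-^ x (suc m) k = cong (seq x k ℚ.*_) (seq-^ x m k)

seq-sum : ∀ {n} (v : Vector ℝ n) k → seq (sum v) k ≡ Q.sum (λ i → seq (v i) k)
seq-sum {zero}  v k = refl
seq-sum {suc n} v k = cong (seq (v zero) k ℚ.+_) (seq-sum (λ i → v (suc i)) k)

seq-product : ∀ {n} (v : Vector ℝ n) k → seq (product v) k ≡ Q.product (λ i → seq (v i) k)
seq-product {zero}  v k = refl
seq-product {suc n} v k = cong (seq (v zero) k ℚ.*_) (seq-product (λ i → v (suc i)) k)

seq-det : ∀ {n} (A : Matrix n) k → seq (det A) k ≡ Q.det (λ i j → seq (A i j) k)
seq-det {zero}  A k = refl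
seq-det {suc n} A k = trans
  (seq-sum (λ j → ((- 1ℝ) ^ toℕ j) * (A zero j * det (λ i l → A (suc i) (punchIn j l)))) k)
  (Q.sum-cong-≋ {suc n} λ j → cong₂ ℚ._*_ (seq-^ (- 1ℝ) (toℕ j) k)
    (cong (seq (A zero j) k ℚ.*_) (seq-det (λ i l → A (suc i) (punchIn j l)) k)))

seq-identity : ∀ {n} (i j : Fin n) k → seq (identity i j) k ≡ Q.δ i j
seq-identity i j k = Bool.if-float (λ x → seq x k) (does (i Fin.≟ j))

-- Vertex zero heads `allFin`, and its adjacency is decided by computation: it is dropped here and
-- kept in `degree-leaf`, which accounts for the `cong suc` there. The remaining vertices all pass
-- the filter here and all fail it there.
degree-centre : ∀ q → Graph.degree (K 1 q) zero ≡ q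
degree-centre q = trans
  (cong length (filter-all (Graph._~?_ (K 1 q) zero)
    (All.tabulate⁺ {f = suc} λ _ → inj₁ (ℕ.s≤s ℕ.z≤n , ℕ.s≤s ℕ.z≤n))))
  (length-tabulate {n = q} suc)

degree-leaf : ∀ q (i : Fin q) → Graph.degree (K 1 q) (suc i) ≡ 1
degree-leaf q i = cong suc (cong length
  (filter-none (Graph._~?_ (K 1 q) (suc i)) (All.tabulate⁺ {f = suc} λ _ → λ
    { (inj₁ (ℕ.s≤s () , _)) ; (inj₂ (_ , ℕ.s≤s ())) })))

charMatrix-star : ∀ m x k i j →
  seq (x * identity i j - randićMatrix (K 1 (suc m)) i j) k ≡
  Q.arrow (seq x k) (ℚ.- seq (1/√ (suc m)) k) i j
charMatrix-star m x k zero zero = trans (ℚ.+-identityʳ (seq x k ℚ.* 1ℚ)) (ℚ.*-identityʳ (seq x k))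
charMatrix-star m x k zero (suc j) = trans
  -- The terms of `1/√ d` are `recipℚ (√-approx d k)` and do not mention the proof that `d` is
  -- nonzero, so a plain `cong` can rewrite the product of the degrees.
  (cong₂ ℚ._+_ (ℚ.*-zeroʳ (seq x k)) (cong (λ d → ℚ.- recipℚ (√-approx d k)) degrees))
  (ℚ.+-identityˡ (ℚ.- seq (1/√ (suc m)) k))
  where
  degrees : Graph.degree (K 1 (suc m)) zero ℕ.* Graph.degree (K 1 (suc m)) (suc j) ≡ suc m
  degrees = trans (cong₂ ℕ._*_ (degree-centre (suc m)) (degree-leaf (suc m) j)) (ℕ.*-identityʳ (suc m))
charMatrix-star m x k (suc i) zero = trans
  (cong₂ ℚ._+_ (ℚ.*-zeroʳ (seq x k)) (cong (λ d → ℚ.- recipℚ (√-approx d k)) degrees))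
  (ℚ.+-identityˡ (ℚ.- seq (1/√ (suc m)) k))
  where
  degrees : Graph.degree (K 1 (suc m)) (suc i) ℕ.* Graph.degree (K 1 (suc m)) zero ≡ suc m
  degrees = trans (cong₂ ℕ._*_ (degree-leaf (suc m) i) (degree-centre (suc m))) (ℕ.*-identityˡ (suc m))
charMatrix-star m x k (suc i) (suc j) = trans
  (ℚ.+-identityʳ (seq x k ℚ.* seq (identity i j) k))
  (cong (seq x k ℚ.*_) (seq-identity i j k))

sum-const : ∀ n y → sum {n} (λ _ → y) ≈ fromℕ n * y
sum-const zero    y = pointwise 0ℝ (fromℕ 0 * y) λ k → sym (ℚ.*-zeroˡ (seq y k))
sum-const (suc n) y = begin
  y + sum {n} (λ _ → y)      ≈⟨ +-cong y y (sum {n} (λ _ → y)) (fromℕ n * y) (≈-refl y) (sum-const n y) ⟩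
  y + fromℕ n * y            ≈⟨ pointwise (y + fromℕ n * y) ((fromℕ 1 + fromℕ n) * y) (λ k →
                                  solve 2 (λ a b → b :+ a :* b := (con 1ℚ :+ a) :* b) refl (seq (fromℕ n) k) (seq y k)) ⟩
  (fromℕ 1 + fromℕ n) * y    ≈⟨ *-cong (fromℕ 1 + fromℕ n) (fromℕ (suc n)) y y (fromℕ-+ 1 n) (≈-refl y) ⟩
  fromℕ (suc n) * y          ∎
  where open +-*-Solver

seq-charPoly : ∀ {n} (A : Matrix n) x k →
               seq (charPoly A x) k ≡ Q.det (λ i j → seq (x * identity i j - A i j) k)
seq-charPoly A x k = seq-det (λ i j → x * identity i j - A i j) k

-- With `∑c²` left unevaluated the identity holds exactly at each index, by `det-arrow` over ℚ. Only
-- the replacement of `∑c²` by 1 is a statement about limits.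
RP-star : ∀ m x → RP (K 1 (suc m)) x ≈ (x ^ m) * ((x ^ 2) - 1ℝ)
RP-star m x = begin
  RP (K 1 (suc m)) x
    ≈⟨ pointwise (RP (K 1 (suc m)) x) ((x ^ m) * ((x ^ 2) - ∑c²)) termwise ⟩
  (x ^ m) * ((x ^ 2) - ∑c²)
    ≈⟨ *-cong (x ^ m) (x ^ m) ((x ^ 2) - ∑c²) ((x ^ 2) - 1ℝ) (≈-refl (x ^ m))
         (+-cong (x ^ 2) (x ^ 2) (- ∑c²) (- 1ℝ) (≈-refl (x ^ 2)) (-‿cong ∑c² 1ℝ ∑c²≈1)) ⟩
  (x ^ m) * ((x ^ 2) - 1ℝ) ∎
  where
  c ∑c² : ℝ
  c = 1/√ (suc m)
  ∑c² = sum {suc m} (λ _ → c * c)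
  ∑c²≈1 : ∑c² ≈ 1ℝ
  ∑c²≈1 = ≈-trans ∑c² (fromℕ (suc m) * (c * c)) 1ℝ (sum-const (suc m) (c * c)) (1/√-square (suc m))
  -p*-p : ∀ p → ℚ.- p ℚ.* ℚ.- p ≡ p ℚ.* p
  -p*-p = solve 1 (λ p → :- p :* :- p := p :* p) refl
    where open +-*-Solver
  termwise : ∀ k → seq (RP (K 1 (suc m)) x) k ≡ seq ((x ^ m) * ((x ^ 2) - ∑c²)) k
  termwise k = trans
    (seq-charPoly (randićMatrix (K 1 (suc m))) x k)
    (trans (Q.det-cong {suc (suc m)} (charMatrix-star m x k))
    (trans (Q.det-arrow m (seq x k) (ℚ.- seq c k))
    (sym (cong₂ ℚ._*_ (seq-^ x m k) (cong₂ ℚ._-_ (seq-^ x 2 k)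
      (trans (seq-sum {suc m} (λ _ → c * c) k)
        (Q.sum-cong-≋ {suc m} λ _ → sym (-p*-p (seq c k)))))))))

-- Apartness from zero and stability of equality

locate : ∀ x ε → 0ℚ ℚ.< ε → x #0 ⊎ ∃[ N ] (∀ n → N ℕ.≤ n → ℚ.∣ seq x n ∣ ℚ.< ε)
-- Comparing the single rational term at `N` with ε/2 is decidable. All terms from `N` on differ by
-- less than δ = ε/4, so they stay below 3ε/4 in one case and at least ε/4 away from zero in the
-- other.
locate x ε 0<ε = decide (ℚ.∣ seq x N ∣ ℚ.<? ½ ℚ.* ε)
  where
  δ : ℚ
  δ = ½ ℚ.* (½ ℚ.* ε)
  0<δ : 0ℚ ℚ.< δ
  0<δ = 0<* 0<½ (0<* 0<½ 0<ε)
  N : ℕ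
  N = proj₁ (cauchy x δ 0<δ)
  near : ∀ m n → N ℕ.≤ m → N ℕ.≤ n → ℚ.∣ seq x m ℚ.- seq x n ∣ ℚ.< δ
  near = proj₂ (cauchy x δ 0<δ)
  δ<½ε : δ ℚ.< ½ ℚ.* ε
  δ<½ε = subst₂ ℚ._<_ (ℚ.+-identityʳ δ) (½ε+½ε≡ε (½ ℚ.* ε)) (ℚ.+-monoʳ-< δ 0<δ)
  decide : Dec (ℚ.∣ seq x N ∣ ℚ.< ½ ℚ.* ε) → x #0 ⊎ ∃[ N ] (∀ n → N ℕ.≤ n → ℚ.∣ seq x n ∣ ℚ.< ε)
  decide (yes xN<) = inj₂ (N , λ n n≥ →
    ℚ.≤-<-trans (∣p∣≤∣q∣+∣p-q∣ (seq x n) (seq x N))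
      (subst (ℚ.∣ seq x N ∣ ℚ.+ ℚ.∣ seq x n ℚ.- seq x N ∣ ℚ.<_) (½ε+½ε≡ε ε)
        (ℚ.+-mono-< xN< (ℚ.<-trans (near n N n≥ ℕ.≤-refl) δ<½ε))))
  decide (no xN≮) = inj₁ (δ , N , 0<δ , λ n n≥ → ℚ.≮⇒≥ λ xn<δ → xN≮
    (ℚ.≤-<-trans (∣p∣≤∣q∣+∣p-q∣ (seq x N) (seq x n))
      (subst (ℚ.∣ seq x n ∣ ℚ.+ ℚ.∣ seq x N ℚ.- seq x n ∣ ℚ.<_) (½ε+½ε≡ε (½ ℚ.* ε))
        (ℚ.+-mono-< xn<δ (near N n ℕ.≤-refl n≥)))))

¬#0⇒≈0 : ∀ x → ¬ x #0 → x ≈ 0ℝ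
¬#0⇒≈0 x ¬x#0 ε 0<ε = [ (λ x#0 → contradiction x#0 ¬x#0) , small ]′ (locate x ε 0<ε)
  where
  small : ∃[ N ] (∀ n → N ℕ.≤ n → ℚ.∣ seq x n ∣ ℚ.< ε) →
          ∃[ N ] (∀ n → N ℕ.≤ n → ℚ.∣ seq x n ℚ.- 0ℚ ∣ ℚ.< ε)
  small (N , h) = N , λ n n≥ →
    subst (λ p → ℚ.∣ p ∣ ℚ.< ε) (sym (ℚ.+-identityʳ (seq x n))) (h n n≥)

-- A refutation would in particular refute `x #0`; then `¬#0⇒≈0` yields the first alternative.
¬¬[≈0⊎#0] : ∀ x → ¬ ¬ (x ≈ 0ℝ ⊎ x #0)
¬¬[≈0⊎#0] x h = h (inj₁ (¬#0⇒≈0 x λ x#0 → h (inj₂ x#0)))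

≈⇒¬#0 : ∀ x y → x ≈ y → ¬ (x - y) #0
≈⇒¬#0 x y x≈y (δ , M , 0<δ , h) =
  let N , k = x≈y δ 0<δ
  in ℚ.<-irrefl refl (ℚ.<-≤-trans (k (M ℕ.⊔ N) (ℕ.m≤n⊔m M N)) (h (M ℕ.⊔ N) (ℕ.m≤m⊔n M N)))

-- For each ε, `locate` either gives the required bound or makes `x - y` apart from zero, which
-- contradicts the double negation. This is what later discharges the case distinction on
-- eigenvalues.
≈-stable : ∀ x y → ¬ ¬ (x ≈ y) → x ≈ y
≈-stable x y ¬¬x≈y ε 0<ε =
  [ (λ x-y#0 → contradiction (λ x≈y → ≈⇒¬#0 x y x≈y x-y#0) ¬¬x≈y) , id ]′ (locate (x - y) ε 0<ε)

#0-cancel : ∀ x y → x #0 → x * y ≈ 0ℝ → y ≈ 0ℝ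
#0-cancel x y x#0 xy≈0 = begin
  y             ≈⟨ pointwise y (1ℝ * y) (λ k → sym (ℚ.*-identityˡ (seq y k))) ⟩
  1ℝ * y        ≈⟨ *-cong 1ℝ (x * r) y y (≈-sym (x * r) 1ℝ (x*recip≈1 x x#0)) (≈-refl y) ⟩
  x * r * y     ≈⟨ pointwise (x * r * y) (r * (x * y)) (λ k →
                     solve 3 (λ a b c → a :* b :* c := b :* (a :* c)) refl (seq x k) (seq r k) (seq y k)) ⟩
  r * (x * y)   ≈⟨ *-cong r r (x * y) 0ℝ (≈-refl r) xy≈0 ⟩
  r * 0ℝ        ≈⟨ pointwise (r * 0ℝ) 0ℝ (λ k → ℚ.*-zeroʳ (seq r k)) ⟩
  0ℝ            ∎
  where
  open +-*-Solver
  r = recip x x#0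

#0-cancel-^ : ∀ m x y → x #0 → (x ^ m) * y ≈ 0ℝ → y ≈ 0ℝ
#0-cancel-^ zero    x y x#0 h = ≈-trans y (1ℝ * y) 0ℝ
  (pointwise y (1ℝ * y) λ k → sym (ℚ.*-identityˡ (seq y k))) h
#0-cancel-^ (suc m) x y x#0 h = #0-cancel-^ m x y x#0 (#0-cancel x ((x ^ m) * y) x#0
  (≈-trans (x * ((x ^ m) * y)) ((x ^ suc m) * y) 0ℝ
    (pointwise (x * ((x ^ m) * y)) ((x ^ suc m) * y) λ k →
      sym (ℚ.*-assoc (seq x k) (seq (x ^ m) k) (seq y k))) h))

data IsSign (x : ℝ) : Set where
  ≈0  : x ≈ 0ℝ → IsSign x
  ≈1  : x ≈ 1ℝ → IsSign x
  ≈-1 : x ≈ - 1ℝ → IsSign x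

-- If `x` is apart from 0, cancelling `x ^ m` leaves `(x - 1ℝ) * (x + 1ℝ)`; if `x - 1ℝ` is apart
-- from 0 too, it cancels as well. For `m = 0` the alternative `≈0` is still allowed here, and the
-- count of zeros excludes it later.
isSign : ∀ m x → (x ^ m) * ((x ^ 2) - 1ℝ) ≈ 0ℝ → ¬ ¬ IsSign x
isSign m x h = do
  inj₂ x#0 ← ¬¬[≈0⊎#0] x
    where inj₁ x≈0 → pure (≈0 x≈0)
  inj₂ x-1#0 ← ¬¬[≈0⊎#0] (x - 1ℝ)
    -- `shift` yields `x ≈ - (- 1ℝ)`, whose terms compute to those of `1ℝ`.
    where inj₁ x-1≈0 → pure (≈1 (shift (- 1ℝ) x-1≈0))
  pure (≈-1 (shift 1ℝ (#0-cancel (x - 1ℝ) (x + 1ℝ) x-1#0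
    (≈-trans ((x - 1ℝ) * (x + 1ℝ)) ((x ^ 2) - 1ℝ) 0ℝ
      (pointwise ((x - 1ℝ) * (x + 1ℝ)) ((x ^ 2) - 1ℝ) λ k →
        solve 1 (λ a → (a :- con 1ℚ) :* (a :+ con 1ℚ) := a :* (a :* con 1ℚ) :- con 1ℚ) refl (seq x k))
      (#0-cancel-^ m x ((x ^ 2) - 1ℝ) x#0 h)))))
  where
  open RawMonad ¬¬-Monad
  open +-*-Solver
  shift : ∀ y → x + y ≈ 0ℝ → x ≈ - y
  shift y x+y≈0 = begin
    x            ≈⟨ pointwise x (x + y - y) (λ k →
                      solve 2 (λ a b → a := a :+ b :- b) refl (seq x k) (seq y k)) ⟩
    x + y - y    ≈⟨ +-cong (x + y) 0ℝ (- y) (- y) x+y≈0 (≈-refl (- y)) ⟩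
    0ℝ - y       ≈⟨ pointwise (0ℝ - y) (- y) (λ k → ℚ.+-identityˡ (ℚ.- seq y k)) ⟩
    - y          ∎

-- The energy

-- Factors 2 are cancelled from both sides until one exponent is zero; if the other were still
-- positive, an odd cofactor would be even.
2-adic-unique : ∀ a b {s t} → 2 ∤ s → 2 ∤ t → 2 ℕ.^ a ℕ.* s ≡ 2 ℕ.^ b ℕ.* t → a ≡ b
2-adic-unique zero    zero    _   _   _  = refl
2-adic-unique zero    (suc b) {s} {t} 2∤s _ e = contradiction
  (subst (2 ∣_) (trans (sym (trans e (ℕ.*-assoc 2 (2 ℕ.^ b) t))) (ℕ.*-identityˡ s)) (m∣m*n (2 ℕ.^ b ℕ.* t))) 2∤s
2-adic-unique (suc a) zero    2∤s 2∤t e = sym (2-adic-unique zero (suc a) 2∤t 2∤s (sym e))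
2-adic-unique (suc a) (suc b) {s} {t} 2∤s 2∤t e = cong suc (2-adic-unique a b 2∤s 2∤t
  (ℕ.*-cancelˡ-≡ _ _ 2 (trans (sym (ℕ.*-assoc 2 (2 ℕ.^ a) s)) (trans e (ℕ.*-assoc 2 (2 ℕ.^ b) t)))))

starSpectrum : ∀ m → Vector ℝ (suc (suc m))
starSpectrum m = 1ℝ ∷ (- 1ℝ) ∷ λ _ → 0ℝ

starSpectrum-product : ∀ m x → product (λ i → x - starSpectrum m i) ≈ (x ^ m) * ((x ^ 2) - 1ℝ)
starSpectrum-product m x =
  pointwise (product (λ i → x - starSpectrum m i)) ((x ^ m) * ((x ^ 2) - 1ℝ)) λ k →
    trans (seq-product (λ i → x - starSpectrum m i) k) (trans
    (cong (λ p → (seq x k ℚ.- 1ℚ) ℚ.* ((seq x k ℚ.- (ℚ.- 1ℚ)) ℚ.* p)) (zeros k))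
    (solve 2 (λ a b → (a :- con 1ℚ) :* ((a :- (:- con 1ℚ)) :* b) := b :* (a :* (a :* con 1ℚ) :- con 1ℚ)) refl
      (seq x k) (seq (x ^ m) k)))
  where
  open +-*-Solver
  zeros : ∀ k → Q.product {m} (λ _ → seq x k ℚ.- 0ℚ) ≡ seq (x ^ m) k
  zeros k = trans (Q.product-cong {m} λ _ → ℚ.+-identityʳ (seq x k))
    (trans (Q.product-replicate m (seq x k)) (sym (seq-^ x m k)))

product-root : ∀ {n} (ρ : Vector ℝ n) i → product (λ j → ρ i - ρ j) ≈ 0ℝ
product-root ρ i = pointwise (product (λ j → ρ i - ρ j)) 0ℝ λ k →
  trans (seq-product (λ j → ρ i - ρ j) k) (Q.product-zero i (ℚ.+-inverseʳ (seq (ρ i) k)))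

-- Evaluated at `x = ρ i`, the product defining the spectrum has a zero factor, so `ρ i` is a root
-- of the polynomial in `RP-star`.
spectrum-isSign : ∀ m ρ → IsSpectrum (randićMatrix (K 1 (suc m))) ρ → ∀ i → ¬ ¬ IsSign (ρ i)
spectrum-isSign m ρ spec i = isSign m (ρ i) (begin
  (ρ i ^ m) * ((ρ i ^ 2) - 1ℝ)   ≈⟨ ≈-sym (RP (K 1 (suc m)) (ρ i)) ((ρ i ^ m) * ((ρ i ^ 2) - 1ℝ)) (RP-star m (ρ i)) ⟩
  RP (K 1 (suc m)) (ρ i)         ≈⟨ spec (ρ i) ⟩
  product (λ j → ρ i - ρ j)      ≈⟨ product-root ρ i ⟩
  0ℝ                             ∎)

fromℕ-^ : ∀ a m → fromℕ a ^ m ≈ fromℕ (a ℕ.^ m)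
fromℕ-^ a m = pointwise (fromℕ a ^ m) (fromℕ (a ℕ.^ m)) λ k → trans (seq-^ (fromℕ a) m k) (power m)
  where
  power : ∀ m → (+ a ℚ./ 1) Q.^ m ≡ + (a ℕ.^ m) ℚ./ 1
  power zero    = refl
  power (suc m) = trans (cong (+ a ℚ./ 1 ℚ.*_) (power m)) (sym (/1-* a (a ℕ.^ m)))

2∤3 : 2 ∤ 3
2∤3 = from-no (2 ∣? 3)

-- A factor 2 - ρᵢ at x = 2 is even exactly when ρᵢ = 0.
Census : ∀ {n} → Vector ℝ n → Set
Census {n} ρ = ∃[ zeros ] ∃[ nonzeros ] ∃[ odd ] (2 ∤ odd × zeros ℕ.+ nonzeros ≡ n ×
  sum (λ i → ∣ ρ i ∣) ≈ fromℕ nonzeros ×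
  product (λ i → fromℕ 2 - ρ i) ≈ fromℕ (2 ℕ.^ zeros ℕ.* odd))

∑-cons : ∀ {n} (ρ : Vector ℝ (suc n)) r a s → ρ zero ≈ r → ∣ r ∣ ≈ fromℕ a →
         sum (λ i → ∣ ρ (suc i) ∣) ≈ fromℕ s → sum (λ i → ∣ ρ i ∣) ≈ fromℕ (a ℕ.+ s)
∑-cons ρ r a s ρ₀≈r ∣r∣≈a h = begin
  ∣ ρ zero ∣ + rest    ≈⟨ +-cong ∣ ρ zero ∣ (fromℕ a) rest (fromℕ s)
                           (≈-trans ∣ ρ zero ∣ ∣ r ∣ (fromℕ a) (∣∣-cong (ρ zero) r ρ₀≈r) ∣r∣≈a) h ⟩
  fromℕ a + fromℕ s    ≈⟨ fromℕ-+ a s ⟩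
  fromℕ (a ℕ.+ s)      ∎
  where rest = sum (λ i → ∣ ρ (suc i) ∣)

∏-cons : ∀ {n} (ρ : Vector ℝ (suc n)) r a p → ρ zero ≈ r → fromℕ 2 - r ≈ fromℕ a →
         product (λ i → fromℕ 2 - ρ (suc i)) ≈ fromℕ p → product (λ i → fromℕ 2 - ρ i) ≈ fromℕ (a ℕ.* p)
∏-cons ρ r a p ρ₀≈r 2-r≈a h = begin
  (fromℕ 2 - ρ zero) * rest ≈⟨ *-cong (fromℕ 2 - ρ zero) (fromℕ a) rest (fromℕ p)
                                (≈-trans (fromℕ 2 - ρ zero) (fromℕ 2 - r) (fromℕ a)
                                  (+-cong (fromℕ 2) (fromℕ 2) (- ρ zero) (- r)
                                    (≈-refl (fromℕ 2)) (-‿cong (ρ zero) r ρ₀≈r)) 2-r≈a) h ⟩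
  fromℕ a * fromℕ p         ≈⟨ fromℕ-* a p ⟩
  fromℕ (a ℕ.* p)           ∎
  where rest = product (λ i → fromℕ 2 - ρ (suc i))

-- The values 0, 1, -1 put the factors 2, 1, 3 into the product at 2 and add 0, 1, 1 to the energy.
census : ∀ {n} (ρ : Vector ℝ n) → (∀ i → IsSign (ρ i)) → Census ρ
census {zero}  ρ _ = 0 , 0 , 1 , from-no (2 ∣? 1) , refl , ≈-refl 0ℝ , ≈-refl 1ℝ
census {suc n} ρ signs = extend (signs zero) (census (λ i → ρ (suc i)) λ i → signs (suc i))
  where
  extend : IsSign (ρ zero) → Census (λ i → ρ (suc i)) → Census ρ
  extend (≈0 ρ₀≈0) (a , s , t , 2∤t , a+s≡n , ∑≈s , ∏≈2^a*t) =
      suc a , s , t , 2∤t , cong suc a+s≡n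
    , ∑-cons ρ 0ℝ 0 s ρ₀≈0 (pointwise ∣ 0ℝ ∣ (fromℕ 0) λ _ → refl) ∑≈s
    , subst (λ p → product (λ i → fromℕ 2 - ρ i) ≈ fromℕ p) (sym (ℕ.*-assoc 2 (2 ℕ.^ a) t))
        (∏-cons ρ 0ℝ 2 (2 ℕ.^ a ℕ.* t) ρ₀≈0
          (pointwise (fromℕ 2 - 0ℝ) (fromℕ 2) λ _ → refl) ∏≈2^a*t)
  extend (≈1 ρ₀≈1) (a , s , t , 2∤t , a+s≡n , ∑≈s , ∏≈2^a*t) =
      a , suc s , t , 2∤t , trans (ℕ.+-suc a s) (cong suc a+s≡n)
    , ∑-cons ρ 1ℝ 1 s ρ₀≈1 (pointwise ∣ 1ℝ ∣ (fromℕ 1) λ _ → refl) ∑≈s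
    , subst (λ p → product (λ i → fromℕ 2 - ρ i) ≈ fromℕ p) (ℕ.*-identityˡ (2 ℕ.^ a ℕ.* t))
        (∏-cons ρ 1ℝ 1 (2 ℕ.^ a ℕ.* t) ρ₀≈1
          (pointwise (fromℕ 2 - 1ℝ) (fromℕ 1) λ _ → refl) ∏≈2^a*t)
  extend (≈-1 ρ₀≈-1) (a , s , t , 2∤t , a+s≡n , ∑≈s , ∏≈2^a*t) =
      a , suc s , 3 ℕ.* t
    -- The factor 3 joins the odd part, which stays odd because 2 is prime.
    , (λ 2∣3*t → [ 2∤3 , 2∤t ]′ (euclidsLemma 3 t prime[2] 2∣3*t))
    , trans (ℕ.+-suc a s) (cong suc a+s≡n)
    , ∑-cons ρ (- 1ℝ) 1 s ρ₀≈-1 (pointwise ∣ - 1ℝ ∣ (fromℕ 1) λ _ → refl) ∑≈s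
    , subst (λ p → product (λ i → fromℕ 2 - ρ i) ≈ fromℕ p) (x∙yz≈y∙xz 3 (2 ℕ.^ a) t)
        (∏-cons ρ (- 1ℝ) 3 (2 ℕ.^ a ℕ.* t) ρ₀≈-1
          (pointwise (fromℕ 2 - (- 1ℝ)) (fromℕ 3) λ _ → refl) ∏≈2^a*t)

RP-star-2 : ∀ m → RP (K 1 (suc m)) (fromℕ 2) ≈ fromℕ (2 ℕ.^ m ℕ.* 3)
RP-star-2 m = begin
  RP (K 1 (suc m)) (fromℕ 2)
    ≈⟨ RP-star m (fromℕ 2) ⟩
  (fromℕ 2 ^ m) * ((fromℕ 2 ^ 2) - 1ℝ)
    ≈⟨ *-cong (fromℕ 2 ^ m) (fromℕ (2 ℕ.^ m)) ((fromℕ 2 ^ 2) - 1ℝ) (fromℕ 3)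
         (fromℕ-^ 2 m) (pointwise ((fromℕ 2 ^ 2) - 1ℝ) (fromℕ 3) λ _ → refl) ⟩
  fromℕ (2 ℕ.^ m) * fromℕ 3
    ≈⟨ fromℕ-* (2 ℕ.^ m) 3 ⟩
  fromℕ (2 ℕ.^ m ℕ.* 3) ∎

-- Unique 2-adic exponents give `a = m`, and `a + s = m + 2` then forces `s = 2`. How the two
-- nonzero values split between 1 and -1 stays open, as both have absolute value 1.
census-energy : ∀ m ρ → IsSpectrum (randićMatrix (K 1 (suc m))) ρ → Census ρ →
         sum (λ i → ∣ ρ i ∣) ≈ fromℕ 2
census-energy m ρ spec (a , s , t , 2∤t , a+s≡n , ∑≈s , ∏≈2^a*t) =
  subst (λ s → sum (λ i → ∣ ρ i ∣) ≈ fromℕ s) s≡2 ∑≈s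
  where
  2^a*t≡2^m*3 : 2 ℕ.^ a ℕ.* t ≡ 2 ℕ.^ m ℕ.* 3
  2^a*t≡2^m*3 = fromℕ-injective (2 ℕ.^ a ℕ.* t) (2 ℕ.^ m ℕ.* 3) (begin
    fromℕ (2 ℕ.^ a ℕ.* t)
      ≈⟨ ≈-sym (product (λ i → fromℕ 2 - ρ i)) (fromℕ (2 ℕ.^ a ℕ.* t)) ∏≈2^a*t ⟩
    product (λ i → fromℕ 2 - ρ i)
      ≈⟨ ≈-sym (RP (K 1 (suc m)) (fromℕ 2)) (product (λ i → fromℕ 2 - ρ i)) (spec (fromℕ 2)) ⟩
    RP (K 1 (suc m)) (fromℕ 2)
      ≈⟨ RP-star-2 m ⟩
    fromℕ (2 ℕ.^ m ℕ.* 3) ∎)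
  s≡2 : s ≡ 2
  s≡2 = ℕ.+-cancelˡ-≡ m s 2 (trans
    (cong (ℕ._+ s) (sym (2-adic-unique a m 2∤t 2∤3 2^a*t≡2^m*3)))
    (trans a+s≡n (ℕ.+-comm 2 m)))

starSpectrum-isSpectrum : ∀ m → IsSpectrum (randićMatrix (K 1 (suc m))) (starSpectrum m)
starSpectrum-isSpectrum m x =
  ≈-trans (RP (K 1 (suc m)) x) ((x ^ m) * ((x ^ 2) - 1ℝ)) (product (λ i → x - starSpectrum m i))
    (RP-star m x)
    (≈-sym (product (λ i → x - starSpectrum m i)) ((x ^ m) * ((x ^ 2) - 1ℝ))
      (starSpectrum-product m x))

-- There are finitely many eigenvalues, so `Fin.sequence` merges their double negations into a
-- single one, which `≈-stable` removes from the conclusion.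
spectrum-energy : ∀ m ρ → IsSpectrum (randićMatrix (K 1 (suc m))) ρ → sum (λ i → ∣ ρ i ∣) ≈ fromℕ 2
spectrum-energy m ρ spec = ≈-stable (sum (λ i → ∣ ρ i ∣)) (fromℕ 2)
  (¬¬-map (λ signs → census-energy m ρ spec (census ρ signs))
    (Fin.sequence (RawMonad.rawApplicative ¬¬-Monad) (spectrum-isSign m ρ spec)))

star-≡ : ∀ {n} → 2 ≤ n → star n ≡ K 1 (suc (n ∸ 2))
star-≡ (ℕ.s≤s (ℕ.s≤s _)) = refl

-- G is kept abstract because comparing RP (star n) with RP (K 1 (suc m)) by
-- unfolding is infeasible.
RP×RE-star : ∀ G m → G ≡ K 1 (suc m) →
             (∀ x → RP G x ≈ (x ^ m) * ((x ^ 2) - 1ℝ)) × (RE G ≈ fromℕ 2)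
RP×RE-star .(K 1 (suc m)) m refl =
  RP-star m , (starSpectrum m , starSpectrum-isSpectrum m) , spectrum-energy m

theorem3 : (n : ℕ) → 2 ≤ n → (∀ x → RP (star n) x ≈ (x ^ (n ∸ 2)) * ((x ^ 2) - 1ℝ)) × (RE (star n) ≈ fromℕ 2)
theorem3 n 2≤n = RP×RE-star (star n) (n ∸ 2) (star-≡ 2≤n)
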